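{- For $i=1,\dots,4$ and each of the three roots $\alpha=e_1,e_2,e_3$ (standard basis vectors) of the lattice $L_i$ with Gram matrix $G_i$, consider the wall lattice $(-K)\oplus U$ with $K=\alpha^\perp\cap L_i$. Let $d\in\{2,3,6\}$ label the wall classes (roots $e_1,e_2,e_3$ respectively). Then each wall class carries exactly two isometry types of wall lattices, partitioning the four lattices as $$d=2:\ \{L_1,L_3\}\mid\{L_2,L_4\},\qquad d=3:\ \{L_1,L_4\}\mid\{L_2,L_3\},\qquad d=6:\ \{L_1,L_2\}\mid\{L_3,L_4\}.$$ With the bigrading $L_1,L_2,L_3,L_4\mapsto(a,b)=(0,0),(1,0),(0,1),(1,1)\in(\mathbb Z/2)^2$, these are the partitions by the bits $a$, $a+b$, $b$ respectively: the three wall classes realize the three nontrivial characters of $(\mathbb Z/2)^2$, one each. In class $d=3$ all four lattices $-K$ have determinant $-12$ and still split $2+2$. In all four lattices the first two roots are orthogonal and the other two pairs of roots are not.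
   Context: $U$ is the hyperbolic plane; $-K$ is $K$ with its form negated. The lattices $L_i=\mathbb Z^3$ have Gram matrices $$G_1=\begin{pmatrix}6&0&-3\\0&4&-2\\-3&-2&2\end{pmatrix},\ G_2=\begin{pmatrix}2&0&-3\\0&12&-6\\-3&-6&6\end{pmatrix},\ G_3=\begin{pmatrix}12&0&-6\\0&2&-2\\-6&-2&4\end{pmatrix},\ G_4=\begin{pmatrix}4&0&-6\\0&6&-6\\-6&-6&12\end{pmatrix}.$$ The class $d$ of a root $\alpha$ of $L_i$ is the squarefree part of $\alpha^2\,|\det G_i|$, which equals $2,3,6$ for $\alpha=e_1,e_2,e_3$ in all four lattices. The twelve binary lattices $-K$ are classified by genus, equivalently the wall lattices $(-K)\oplus U$ by isometry. -}

module Defs where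

open import Level using (0ℓ)
open import Algebra.Bundles using (CommutativeRing; Group)
import Algebra.Construct.DirectProduct as GroupProduct
open import Algebra.Module.Bundles using (LeftModule)
import Algebra.Module.Construct.DirectProduct as ModuleProduct
open import Algebra.Module.Morphism.Structures using (module LeftModuleMorphisms)
open import Algebra.Morphism.Structures using (module GroupMorphisms)
import Algebra.Properties.CommutativeSemigroup as CommutativeSemigroupProperties
import Algebra.Properties.Monoid.Sum as MonoidSum
import Algebra.Properties.Ring as RingProperties
import Algebra.Properties.Semiring.Sum as SemiringSum
open import Data.Fin.Base using (Fin; toℕ; punchIn) renaming (zero to fzero; suc to fsuc)
open import Data.Fin.Properties using (all?)
open import Data.Integer.Base using (ℤ; +_; -[1+_]; 0ℤ; 1ℤ; -1ℤ; ∣_∣)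
import Data.Integer.Base as ℤ
open import Data.Integer.Divisibility.Signed using (_∣_; divides; ∣m∣n⇒∣m+n; ∣m⇒∣-m; ∣n⇒∣m*n; ∣m⇒∣m*n)
import Data.Integer.Properties as ℤₚ
open import Data.Integer.Tactic.RingSolver using (solve-∀)
open import Data.List.Base using (List)
open import Data.List.Membership.Propositional using (_∈_)
open import Data.Nat.Base using (ℕ; zero; suc)
import Data.Nat.Base as ℕ
import Data.Nat.Divisibility as ℕDiv
open import Data.Nat.Primality using (Prime)
open import Data.Parity.Base using (Parity; 0ℙ; 1ℙ) renaming (_+_ to _+ℙ_)
open import Data.Parity.Properties using () renaming (+-0-group to ℤ/2)
open import Data.Product using (Σ; ∃; ∃₂; Σ-syntax; ∃-syntax; _×_; _,_; proj₁; proj₂)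
open import Data.Sum.Base using (_⊎_)
open import Data.Vec.Functional using (Vector; []; _∷_)
open import Function.Bundles using (_⇔_)
open import Relation.Binary.PropositionalEquality using (_≡_; _≢_; refl; subst)
open import Relation.Nullary using (¬_)
open import Relation.Nullary.Decidable using (from-yes)

module Bilinear (R : CommutativeRing 0ℓ 0ℓ) where

  private module R = CommutativeRing R
  open SemiringSum R.semiring using (sum; sum-cong-≋; ∑-distrib-+; ∑-comm; *-distribˡ-sum)

  -- Finite freeness is not a field: it is carried by `Basis` below, so that
  -- orthogonal complements can be formed without choosing a basis of them.
  record Lattice : Set₁ where
    infix 5 ⟨_,_⟩
    field
      leftModule : LeftModule R.ring 0ℓ 0ℓ

    open LeftModule leftModule public

    field
      ⟨_,_⟩  : Carrierᴹ → Carrierᴹ → R.Carrier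
      ⟨⟩-cong : ∀ {x x′ y y′} → x ≈ᴹ x′ → y ≈ᴹ y′ → ⟨ x , y ⟩ R.≈ ⟨ x′ , y′ ⟩
      ⟨⟩-sym  : ∀ x y → ⟨ x , y ⟩ R.≈ ⟨ y , x ⟩
      ⟨⟩-+    : ∀ x x′ y → ⟨ x +ᴹ x′ , y ⟩ R.≈ ⟨ x , y ⟩ R.+ ⟨ x′ , y ⟩
      ⟨⟩-*    : ∀ r x y → ⟨ r *ₗ x , y ⟩ R.≈ r R.* ⟨ x , y ⟩

    combination : ∀ {n} → Vector R.Carrier n → Vector Carrierᴹ n → Carrierᴹ
    combination c v = sumᴹ λ i → c i *ₗ v i
      where open MonoidSum +ᴹ-monoid using () renaming (sum to sumᴹ)

  infix 4 _≅_

  _≅_ : Lattice → Lattice → Set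
  L ≅ M = Σ[ f ∈ (L.Carrierᴹ → M.Carrierᴹ) ]
            IsLeftModuleIsomorphism f × (∀ x y → M.⟨ f x , f y ⟩ R.≈ L.⟨ x , y ⟩)
    where
    module L = Lattice L
    module M = Lattice M
    open LeftModuleMorphisms L.rawLeftModule M.rawLeftModule

  Matrix : ℕ → Set
  Matrix n = Fin n → Fin n → R.Carrier

  Symmetric : ∀ {n} → Matrix n → Set
  Symmetric A = ∀ i j → A i j R.≈ A j i

  freeModule : ℕ → LeftModule R.ring 0ℓ 0ℓ
  freeModule n = record
    { Carrierᴹ = Vector R.Carrier n
    ; _≈ᴹ_ = λ x y → ∀ i → x i R.≈ y i
    ; _+ᴹ_ = λ x y i → x i R.+ y i
    ; _*ₗ_ = λ r x i → r R.* x i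
    ; 0ᴹ = λ _ → R.0#
    ; -ᴹ_ = λ x i → R.- x i
    ; isLeftModule = record
      { isLeftSemimodule = record
        { +ᴹ-isCommutativeMonoid = record
          { isMonoid = record
            { isSemigroup = record
              { isMagma = record
                { isEquivalence = record
                  { refl = λ _ → R.refl
                  ; sym = λ p i → R.sym (p i)
                  ; trans = λ p q i → R.trans (p i) (q i)
                  }
                ; ∙-cong = λ p q i → R.+-cong (p i) (q i)
                }
              ; assoc = λ x y z i → R.+-assoc (x i) (y i) (z i)
              }
            ; identity = (λ x i → R.+-identityˡ (x i)) , (λ x i → R.+-identityʳ (x i))
            }
          ; comm = λ x y i → R.+-comm (x i) (y i)
          }
        ; isPreleftSemimodule = record
          { *ₗ-cong = λ r p i → R.*-cong r (p i)
          ; *ₗ-zeroˡ = λ x i → R.zeroˡ (x i)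
          ; *ₗ-distribʳ = λ x r s i → R.distribʳ (x i) r s
          ; *ₗ-identityˡ = λ x i → R.*-identityˡ (x i)
          ; *ₗ-assoc = λ r s x i → R.*-assoc r s (x i)
          ; *ₗ-zeroʳ = λ r i → R.zeroʳ r
          ; *ₗ-distribˡ = λ r x y i → R.distribˡ r (x i) (y i)
          }
        }
      ; -ᴹ‿cong = λ p i → R.-‿cong (p i)
      ; -ᴹ‿inverse = (λ x i → R.-‿inverseˡ (x i)) , (λ x i → R.-‿inverseʳ (x i))
      }
    }

  -- Rⁿ with the form xᵀ A y.
  gramLattice : ∀ {n} (A : Matrix n) → Symmetric A → Lattice
  gramLattice {n} A A-sym = record
    { leftModule = freeModule n
    ; ⟨_,_⟩ = λ x y → sum λ i → sum λ j → x i R.* (A i j R.* y j)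
    ; ⟨⟩-cong = λ p q → sum-cong-≋ λ i → sum-cong-≋ λ j → R.*-cong (p i) (R.*-congˡ (q j))
    ; ⟨⟩-sym = λ x y → R.trans
        (∑-comm λ i j → x i R.* (A i j R.* y j))
        (sum-cong-≋ λ j → sum-cong-≋ λ i → swap (A-sym i j))
    ; ⟨⟩-+ = λ x x′ y → R.trans
        (sum-cong-≋ λ i → R.trans
          (sum-cong-≋ λ j → R.distribʳ (A i j R.* y j) (x i) (x′ i))
          (∑-distrib-+ (λ j → x i R.* (A i j R.* y j)) (λ j → x′ i R.* (A i j R.* y j))))
        (∑-distrib-+ (λ i → sum λ j → x i R.* (A i j R.* y j))
                     (λ i → sum λ j → x′ i R.* (A i j R.* y j)))
    ; ⟨⟩-* = λ r x y → R.sym (R.trans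
        (*-distribˡ-sum r (λ i → sum λ j → x i R.* (A i j R.* y j)))
        (sum-cong-≋ λ i → R.trans
          (*-distribˡ-sum r (λ j → x i R.* (A i j R.* y j)))
          (sum-cong-≋ λ j → R.sym (R.*-assoc r (x i) (A i j R.* y j)))))
    }
    where
    swap : ∀ {a b c d} → b R.≈ d → a R.* (b R.* c) R.≈ c R.* (d R.* a)
    swap {a} {b} {c} {d} b≈d = R.trans (R.*-comm a (b R.* c))
      (R.trans (R.*-congʳ (R.trans (R.*-comm b c) (R.*-congˡ b≈d))) (R.*-assoc c d a))

  negate : Lattice → Lattice
  negate L = record
    { leftModule = leftModule
    ; ⟨_,_⟩ = λ x y → R.- ⟨ x , y ⟩
    ; ⟨⟩-cong = λ p q → R.-‿cong (⟨⟩-cong p q)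
    ; ⟨⟩-sym = λ x y → R.-‿cong (⟨⟩-sym x y)
    ; ⟨⟩-+ = λ x x′ y → R.trans (R.-‿cong (⟨⟩-+ x x′ y)) (R.sym (-‿+-comm _ _))
    ; ⟨⟩-* = λ r x y → R.trans (R.-‿cong (⟨⟩-* r x y)) (-‿distribʳ-* r _)
    }
    where
    open Lattice L
    open RingProperties R.ring using (-‿+-comm; -‿distribʳ-*)

  infixr 6 _⊕_

  _⊕_ : Lattice → Lattice → Lattice
  L ⊕ M = record
    { leftModule = ModuleProduct.leftModule L.leftModule M.leftModule
    ; ⟨_,_⟩ = λ (x , u) (y , v) → L.⟨ x , y ⟩ R.+ M.⟨ u , v ⟩
    ; ⟨⟩-cong = λ (p , p′) (q , q′) → R.+-cong (L.⟨⟩-cong p q) (M.⟨⟩-cong p′ q′)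
    ; ⟨⟩-sym = λ (x , u) (y , v) → R.+-cong (L.⟨⟩-sym x y) (M.⟨⟩-sym u v)
    ; ⟨⟩-+ = λ (x , u) (x′ , u′) (y , v) →
        R.trans (R.+-cong (L.⟨⟩-+ x x′ y) (M.⟨⟩-+ u u′ v)) (interchange _ _ _ _)
    ; ⟨⟩-* = λ r (x , u) (y , v) →
        R.trans (R.+-cong (L.⟨⟩-* r x y) (M.⟨⟩-* r u v)) (R.sym (R.distribˡ r _ _))
    }
    where
    module L = Lattice L
    module M = Lattice M
    open CommutativeSemigroupProperties R.+-commutativeSemigroup using (interchange)

  -- α^⊥ ∩ L with the restricted form; elements are equal when equal in L.
  orthogonal : (L : Lattice) → Lattice.Carrierᴹ L → Lattice
  orthogonal L α = record
    { leftModule = record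
      { Carrierᴹ = Σ[ x ∈ Carrierᴹ ] ⟨ x , α ⟩ R.≈ R.0#
      ; _≈ᴹ_ = λ x y → proj₁ x ≈ᴹ proj₁ y
      ; _+ᴹ_ = λ (x , p) (y , q) → x +ᴹ y ,
          R.trans (⟨⟩-+ x y α) (R.trans (R.+-cong p q) (R.+-identityˡ R.0#))
      ; _*ₗ_ = λ r (x , p) → r *ₗ x ,
          R.trans (⟨⟩-* r x α) (R.trans (R.*-congˡ p) (R.zeroʳ r))
      ; 0ᴹ = 0ᴹ , 0-orth
      ; -ᴹ_ = λ (x , p) → -ᴹ x , neg-orth x p
      ; isLeftModule = record
        { isLeftSemimodule = record
          { +ᴹ-isCommutativeMonoid = record
            { isMonoid = record
              { isSemigroup = record
                { isMagma = record
                  { isEquivalence = record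
                    { refl = ≈ᴹ-refl ; sym = ≈ᴹ-sym ; trans = ≈ᴹ-trans }
                  ; ∙-cong = +ᴹ-cong
                  }
                ; assoc = λ x y z → +ᴹ-assoc (proj₁ x) (proj₁ y) (proj₁ z)
                }
              ; identity = (λ x → +ᴹ-identityˡ (proj₁ x)) , (λ x → +ᴹ-identityʳ (proj₁ x))
              }
            ; comm = λ x y → +ᴹ-comm (proj₁ x) (proj₁ y)
            }
          ; isPreleftSemimodule = record
            { *ₗ-cong = *ₗ-cong
            ; *ₗ-zeroˡ = λ x → *ₗ-zeroˡ (proj₁ x)
            ; *ₗ-distribʳ = λ x → *ₗ-distribʳ (proj₁ x)
            ; *ₗ-identityˡ = λ x → *ₗ-identityˡ (proj₁ x)
            ; *ₗ-assoc = λ r s x → *ₗ-assoc r s (proj₁ x)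
            ; *ₗ-zeroʳ = *ₗ-zeroʳ
            ; *ₗ-distribˡ = λ r x y → *ₗ-distribˡ r (proj₁ x) (proj₁ y)
            }
          }
        ; -ᴹ‿cong = -ᴹ‿cong
        ; -ᴹ‿inverse = (λ x → -ᴹ‿inverseˡ (proj₁ x)) , (λ x → -ᴹ‿inverseʳ (proj₁ x))
        }
      }
    ; ⟨_,_⟩ = λ x y → ⟨ proj₁ x , proj₁ y ⟩
    ; ⟨⟩-cong = ⟨⟩-cong
    ; ⟨⟩-sym = λ x y → ⟨⟩-sym (proj₁ x) (proj₁ y)
    ; ⟨⟩-+ = λ x x′ y → ⟨⟩-+ (proj₁ x) (proj₁ x′) (proj₁ y)
    ; ⟨⟩-* = λ r x y → ⟨⟩-* r (proj₁ x) (proj₁ y)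
    }
    where
    open Lattice L

    0-orth : ⟨ 0ᴹ , α ⟩ R.≈ R.0#
    0-orth = R.trans (⟨⟩-cong (≈ᴹ-sym (*ₗ-zeroˡ 0ᴹ)) ≈ᴹ-refl)
               (R.trans (⟨⟩-* R.0# 0ᴹ α) (R.zeroˡ _))

    neg-orth : ∀ x → ⟨ x , α ⟩ R.≈ R.0# → ⟨ -ᴹ x , α ⟩ R.≈ R.0#
    neg-orth x p =
      R.trans (R.sym (R.+-identityʳ _))
      (R.trans (R.+-congˡ (R.sym p))
      (R.trans (R.sym (⟨⟩-+ (-ᴹ x) x α))
      (R.trans (⟨⟩-cong (-ᴹ‿inverseˡ x) ≈ᴹ-refl) 0-orth)))

  record Basis (L : Lattice) (n : ℕ) : Set where
    open Lattice L
    field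
      vec         : Fin n → Carrierᴹ
      spanning    : ∀ x → ∃[ c ] combination c vec ≈ᴹ x
      independent : ∀ c → combination c vec ≈ᴹ 0ᴹ → ∀ i → c i R.≈ R.0#

    gram : Matrix n
    gram i j = ⟨ vec i , vec j ⟩

    gram-sym : Symmetric gram
    gram-sym i j = ⟨⟩-sym (vec i) (vec j)

infix 4 _≡_[mod_]

-- A record, so that x and y can be inferred from a congruence.
record _≡_[mod_] (x y m : ℤ) : Set where
  constructor congruent
  field
    divisible : m ∣ x ℤ.- y

module Mod (m : ℤ) where

  ≡⇒≡mod : ∀ {x y} → x ≡ y → x ≡ y [mod m ]
  ≡⇒≡mod {x} refl = congruent (divides 0ℤ (ℤₚ.+-inverseʳ x))

  sym-mod : ∀ {x y} → x ≡ y [mod m ] → y ≡ x [mod m ]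
  sym-mod {x} {y} (congruent p) = congruent (subst (m ∣_) (eq x y) (∣m⇒∣-m p))
    where
    eq : ∀ x y → ℤ.- (x ℤ.- y) ≡ y ℤ.- x
    eq = solve-∀

  trans-mod : ∀ {x y z} → x ≡ y [mod m ] → y ≡ z [mod m ] → x ≡ z [mod m ]
  trans-mod {x} {y} {z} (congruent p) (congruent q) = congruent (subst (m ∣_) (eq x y z) (∣m∣n⇒∣m+n p q))
    where
    eq : ∀ x y z → (x ℤ.- y) ℤ.+ (y ℤ.- z) ≡ x ℤ.- z
    eq = solve-∀

  +-mod : ∀ {x x′ y y′} → x ≡ x′ [mod m ] → y ≡ y′ [mod m ] → x ℤ.+ y ≡ x′ ℤ.+ y′ [mod m ]
  +-mod {x} {x′} {y} {y′} (congruent p) (congruent q) = congruent (subst (m ∣_) (eq x x′ y y′) (∣m∣n⇒∣m+n p q))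
    where
    eq : ∀ x x′ y y′ → (x ℤ.- x′) ℤ.+ (y ℤ.- y′) ≡ (x ℤ.+ y) ℤ.- (x′ ℤ.+ y′)
    eq = solve-∀

  *-mod : ∀ {x x′ y y′} → x ≡ x′ [mod m ] → y ≡ y′ [mod m ] → x ℤ.* y ≡ x′ ℤ.* y′ [mod m ]
  *-mod {x} {x′} {y} {y′} (congruent p) (congruent q) = congruent (subst (m ∣_) (eq x x′ y y′)
      (∣m∣n⇒∣m+n (∣m⇒∣m*n y p) (∣n⇒∣m*n x′ q)))
    where
    eq : ∀ x x′ y y′ → (x ℤ.- x′) ℤ.* y ℤ.+ x′ ℤ.* (y ℤ.- y′) ≡ x ℤ.* y ℤ.- x′ ℤ.* y′
    eq = solve-∀

  neg-mod : ∀ {x x′} → x ≡ x′ [mod m ] → ℤ.- x ≡ ℤ.- x′ [mod m ]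
  neg-mod {x} {x′} (congruent p) = congruent (subst (m ∣_) (eq x x′) (∣m⇒∣-m p))
    where
    eq : ∀ x x′ → ℤ.- (x ℤ.- x′) ≡ ℤ.- x ℤ.- ℤ.- x′
    eq = solve-∀

-- An element of the inverse limit of the ℤ/pᵏ.
record PAdicInteger (p : ℕ) : Set where
  field
    residue  : ℕ → ℤ
    coherent : ∀ k → residue (suc k) ≡ residue k [mod (+ p) ℤ.^ k ]

open PAdicInteger public

constant : ∀ {p} → ℤ → PAdicInteger p
constant a = record { residue = λ _ → a ; coherent = λ k → Mod.≡⇒≡mod _ refl }

pAdicIntegers : ℕ → CommutativeRing 0ℓ 0ℓ
pAdicIntegers p = record
  { Carrier = PAdicInteger p
  ; _≈_ = λ x y → ∀ k → residue x k ≡ residue y k [mod (+ p) ℤ.^ k ]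
  ; _+_ = λ x y → record
      { residue = λ k → residue x k ℤ.+ residue y k
      ; coherent = λ k → M.+-mod k (coherent x k) (coherent y k) }
  ; _*_ = λ x y → record
      { residue = λ k → residue x k ℤ.* residue y k
      ; coherent = λ k → M.*-mod k (coherent x k) (coherent y k) }
  ; -_ = λ x → record
      { residue = λ k → ℤ.- residue x k
      ; coherent = λ k → M.neg-mod k (coherent x k) }
  ; 0# = constant 0ℤ
  ; 1# = constant 1ℤ
  ; isCommutativeRing = record
    { isRing = record
      { +-isAbelianGroup = record
        { isGroup = record
          { isMonoid = record
            { isSemigroup = record
              { isMagma = record
                { isEquivalence = record
                  { refl = λ k → M.≡⇒≡mod k refl
                  ; sym = λ e k → M.sym-mod k (e k)
                  ; trans = λ e f k → M.trans-mod k (e k) (f k)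
                  }
                ; ∙-cong = λ e f k → M.+-mod k (e k) (f k)
                }
              ; assoc = λ x y z k → M.≡⇒≡mod k (ℤₚ.+-assoc (residue x k) (residue y k) (residue z k))
              }
            ; identity = (λ x k → M.≡⇒≡mod k (ℤₚ.+-identityˡ (residue x k)))
                       , (λ x k → M.≡⇒≡mod k (ℤₚ.+-identityʳ (residue x k)))
            }
          ; inverse = (λ x k → M.≡⇒≡mod k (ℤₚ.+-inverseˡ (residue x k)))
                    , (λ x k → M.≡⇒≡mod k (ℤₚ.+-inverseʳ (residue x k)))
          ; ⁻¹-cong = λ e k → M.neg-mod k (e k)
          }
        ; comm = λ x y k → M.≡⇒≡mod k (ℤₚ.+-comm (residue x k) (residue y k))
        }
      ; *-cong = λ e f k → M.*-mod k (e k) (f k)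
      ; *-assoc = λ x y z k → M.≡⇒≡mod k (ℤₚ.*-assoc (residue x k) (residue y k) (residue z k))
      ; *-identity = (λ x k → M.≡⇒≡mod k (ℤₚ.*-identityˡ (residue x k)))
                   , (λ x k → M.≡⇒≡mod k (ℤₚ.*-identityʳ (residue x k)))
      ; distrib = (λ x y z k → M.≡⇒≡mod k (ℤₚ.*-distribˡ-+ (residue x k) (residue y k) (residue z k)))
                , (λ x y z k → M.≡⇒≡mod k (ℤₚ.*-distribʳ-+ (residue x k) (residue y k) (residue z k)))
      }
    ; *-comm = λ x y k → M.≡⇒≡mod k (ℤₚ.*-comm (residue x k) (residue y k))
    }
  }
  where module M (k : ℕ) = Mod ((+ p) ℤ.^ k)

open Bilinear ℤₚ.+-*-commutativeRing public

-- Laplace expansion along the first row.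
det : ∀ {n} → Matrix n → ℤ
det {zero}  A = 1ℤ
det {suc n} A = sum λ j → -1ℤ ℤ.^ toℕ j ℤ.* (A fzero j ℤ.* det (λ i k → A (fsuc i) (punchIn j k)))
  where open SemiringSum ℤₚ.+-*-semiring using (sum)

-- The value does not depend on the basis.
HasDeterminant : Lattice → ℕ → ℤ → Set
HasDeterminant L n d = Σ[ b ∈ Basis L n ] det (Basis.gram b) ≡ d

-- Indivisible, of positive norm, with integral reflection x ↦ x − (2⟨α,x⟩/⟨α,α⟩) α.
record IsRoot (L : Lattice) (α : Lattice.Carrierᴹ L) : Set where
  open Lattice L
  field
    indivisible : ∀ m x → α ≈ᴹ m *ₗ x → ∣ m ∣ ≡ 1
    positive    : 0ℤ ℤ.< ⟨ α , α ⟩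
    reflection  : ∀ x → ⟨ α , α ⟩ ∣ (+ 2) ℤ.* ⟨ α , x ⟩

Squarefree : ℕ → Set
Squarefree d = ∀ m → m ℕ.* m ℕDiv.∣ d → m ≡ 1

IsSquarefreePart : ℤ → ℕ → Set
IsSquarefreePart n d = Squarefree d × ∃[ m ] m ≢ 0 × n ≡ + (d ℕ.* (m ℕ.* m))

-- L ⊗ ℤₚ, written in the coordinates of a basis of L.
localise : ∀ (p : ℕ) {L n} → Basis L n → Bilinear.Lattice (pAdicIntegers p)
localise p b = Bilinear.gramLattice (pAdicIntegers p)
  (λ i j → constant (gram i j)) (λ i j k → Mod.≡⇒≡mod _ (gram-sym i j))
  where open Basis b

-- Sylvester: mutually orthogonal vectors of L, s of positive and t of negative
-- norm, where s + t is the rank.  Such vectors form a basis of L ⊗ ℝ, and they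
-- exist for every nondegenerate L (Gram–Schmidt over ℚ, clearing denominators).
record HasSignature (L : Lattice) (s t : ℕ) : Set where
  open Lattice L
  field
    basis    : Basis L (s ℕ.+ t)
    pos      : Fin s → Carrierᴹ
    neg      : Fin t → Carrierᴹ
    pos-norm : ∀ i → 0ℤ ℤ.< ⟨ pos i , pos i ⟩
    neg-norm : ∀ i → ⟨ neg i , neg i ⟩ ℤ.< 0ℤ
    pos-orth : ∀ i j → i ≢ j → ⟨ pos i , pos j ⟩ ≡ 0ℤ
    neg-orth : ∀ i j → i ≢ j → ⟨ neg i , neg j ⟩ ≡ 0ℤ
    orth     : ∀ i j → ⟨ pos i , neg j ⟩ ≡ 0ℤ

-- Isometric over ℤₚ for all primes p and over ℝ, for nondegenerate lattices.
SameGenus : Lattice → Lattice → Set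
SameGenus L M =
  (∃[ n ] Σ[ b ∈ Basis L n ] Σ[ c ∈ Basis M n ]
     (∀ p → Prime p → Bilinear._≅_ (pAdicIntegers p) (localise p b) (localise p c)))
  × (∃₂ λ s t → HasSignature L s t × HasSignature M s t)

data Index : Set where
  L₁ L₂ L₃ L₄ : Index

G : Index → Matrix 3
G L₁ = (+ 6 ∷ + 0 ∷ -[1+ 2 ] ∷ [])
     ∷ (+ 0 ∷ + 4 ∷ -[1+ 1 ] ∷ [])
     ∷ (-[1+ 2 ] ∷ -[1+ 1 ] ∷ + 2 ∷ [])
     ∷ []
G L₂ = (+ 2 ∷ + 0 ∷ -[1+ 2 ] ∷ [])
     ∷ (+ 0 ∷ + 12 ∷ -[1+ 5 ] ∷ [])
     ∷ (-[1+ 2 ] ∷ -[1+ 5 ] ∷ + 6 ∷ [])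
     ∷ []
G L₃ = (+ 12 ∷ + 0 ∷ -[1+ 5 ] ∷ [])
     ∷ (+ 0 ∷ + 2 ∷ -[1+ 1 ] ∷ [])
     ∷ (-[1+ 5 ] ∷ -[1+ 1 ] ∷ + 4 ∷ [])
     ∷ []
G L₄ = (+ 4 ∷ + 0 ∷ -[1+ 5 ] ∷ [])
     ∷ (+ 0 ∷ + 6 ∷ -[1+ 5 ] ∷ [])
     ∷ (-[1+ 5 ] ∷ -[1+ 5 ] ∷ + 12 ∷ [])
     ∷ []

G-sym : ∀ i → Symmetric (G i)
G-sym L₁ = from-yes (all? λ i → all? λ j → G L₁ i j ℤₚ.≟ G L₁ j i)
G-sym L₂ = from-yes (all? λ i → all? λ j → G L₂ i j ℤₚ.≟ G L₂ j i)
G-sym L₃ = from-yes (all? λ i → all? λ j → G L₃ i j ℤₚ.≟ G L₃ j i)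
G-sym L₄ = from-yes (all? λ i → all? λ j → G L₄ i j ℤₚ.≟ G L₄ j i)

lattice : Index → Lattice
lattice i = gramLattice (G i) (G-sym i)

module _ (i : Index) where
  open Lattice (lattice i) public using () renaming (⟨_,_⟩ to form)

e₁ e₂ e₃ : Vector ℤ 3
e₁ = 1ℤ ∷ 0ℤ ∷ 0ℤ ∷ []
e₂ = 0ℤ ∷ 1ℤ ∷ 0ℤ ∷ []
e₃ = 0ℤ ∷ 0ℤ ∷ 1ℤ ∷ []

data WallClass : Set where
  d=2 d=3 d=6 : WallClass

label : WallClass → ℕ
label d=2 = 2
label d=3 = 3
label d=6 = 6

root : WallClass → Vector ℤ 3
root d=2 = e₁
root d=3 = e₂
root d=6 = e₃

U : Lattice
U = gramLattice A (from-yes (all? λ i → all? λ j → A i j ℤₚ.≟ A j i))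
  where
  A : Matrix 2
  A = (0ℤ ∷ 1ℤ ∷ []) ∷ (1ℤ ∷ 0ℤ ∷ []) ∷ []

K : WallClass → Index → Lattice
K d i = orthogonal (lattice i) (root d)

wall : WallClass → Index → Lattice
wall d i = negate (K d i) ⊕ U

infix 3 _IsPartition_∣∣_

_IsPartition_∣∣_ : (Index → Index → Set) → List Index → List Index → Set
_~_ IsPartition A ∣∣ B = ∀ i j → (i ~ j) ⇔ ((i ∈ A × j ∈ A) ⊎ (i ∈ B × j ∈ B))

ExactlyTwoClasses : (Index → Index → Set) → Set
ExactlyTwoClasses _~_ = ∃₂ λ i j → ¬ (i ~ j) × (∀ k → (k ~ i) ⊎ (k ~ j))

SameWall : WallClass → Index → Index → Set
SameWall d i j = wall d i ≅ wall d j

[ℤ/2]² : Group 0ℓ 0ℓ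
[ℤ/2]² = GroupProduct.group ℤ/2 ℤ/2

bits : Index → Parity × Parity
bits L₁ = 0ℙ , 0ℙ
bits L₂ = 1ℙ , 0ℙ
bits L₃ = 0ℙ , 1ℙ
bits L₄ = 1ℙ , 1ℙ

-- Characters of a group of exponent 2, with the values ±1 written additively.
NontrivialCharacter : (Parity × Parity → Parity) → Set
NontrivialCharacter f = IsGroupHomomorphism f × ∃[ g ] f g ≢ 0ℙ
  where open GroupMorphisms (Group.rawGroup [ℤ/2]²) (Group.rawGroup ℤ/2)

χ : WallClass → Parity × Parity → Parity
χ d=2 (a , b) = a
χ d=3 (a , b) = a +ℙ b
χ d=6 (a , b) = b

Realizes : WallClass → (Parity × Parity → Parity) → Set
Realizes d f = ∀ i j → SameWall d i j ⇔ (f (bits i) ≡ f (bits j))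

{-# OPTIONS --safe #-}

-- Each −K has an orthogonal basis whose two norms depend only on d and χ d at the lattice, so equal
-- characters give isometric wall lattices.  Conversely, the vectors of the wall lattice that are
-- orthogonal to everything modulo 3 represent 6 modulo 9 exactly when χ d = 1, an isometry invariant.
-- For d = 3 the two candidates ⟨2⟩ ⊕ ⟨−6⟩ and ⟨−2⟩ ⊕ ⟨6⟩ for −K lie in different genera because
-- their nonzero norms modulo 3 differ.
module Submission where

open import Defs
open import Data.Integer.Base using (+_; -_; _*_; ∣_∣; 0ℤ)
open import Data.List.Base using ([]; _∷_)
open import Data.Product using (_×_; ∃!)
open import Relation.Binary.PropositionalEquality using (_≡_; _≢_)

open import Algebra.Bundles using (CommutativeRing; Group)
open import Algebra.Module.Bundles using (LeftModule)
open import Algebra.Module.Morphism.Structures using (module LeftModuleMorphisms)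
open import Algebra.Morphism.Structures using (module GroupMorphisms)
import Algebra.Module.Morphism.Construct.Identity as Identity
import Algebra.Properties.CommutativeMonoid.Sum as CommutativeMonoidSum
import Algebra.Properties.CommutativeSemigroup as CommutativeSemigroupProperties
import Algebra.Properties.Group as GroupProperties
import Algebra.Properties.Semiring.Sum as SemiringSum
open import Data.Fin.Base using (Fin; toℕ; fromℕ<) renaming (zero to fzero; suc to fsuc)
open import Data.Fin.Patterns using (0F; 1F; 2F)
open import Data.Fin.Properties using (all?; toℕ-fromℕ<)
open import Data.Integer.Base using (ℤ; 1ℤ; -1ℤ; _+_; _-_)
import Data.Integer.Base as ℤ
open import Data.Integer.DivMod using (_%ℕ_; _/ℕ_; a≡a%ℕn+[a/ℕn]*n; n%ℕd<d)
open import Data.Integer.Divisibility.Signed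
  using (_∣_; _∣?_; divides; ∣m∣n⇒∣m+n; ∣m⇒∣-m; ∣n⇒∣m*n; ∣m⇒∣m*n)
import Data.Integer.Properties as ℤₚ
open import Data.Integer.Tactic.RingSolver using (solve-∀)
import Data.List.Membership.DecPropositional as DecMembership
open import Data.Nat.Base using (ℕ; zero; suc; NonZero)
import Data.Nat.Base as ℕ
import Data.Nat.Divisibility as ℕDiv
open import Data.Nat.Primality using (prime?)
import Data.Nat.Properties as ℕₚ
open import Data.Parity.Base using (Parity; 0ℙ; 1ℙ) renaming (_+_ to _+ℙ_; _*_ to _*ℙ_)
import Data.Parity.Properties as ℙₚ
open import Data.Parity.Properties using () renaming (+-0-group to ℤ/2)
open import Data.Product using (∃-syntax; _,_; proj₁; proj₂)
open import Data.Sum.Base as Sum using (_⊎_; inj₁; inj₂)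
open import Data.Vec.Functional using (Vector) renaming ([] to []ᵛ; _∷_ to _∷ᵛ_)
open import Function.Base using (_∘_; id)
open import Function.Bundles using (_⇔_; mk⇔; Equivalence)
open import Function.Construct.Composition using (_⇔-∘_)
open import Relation.Binary.PropositionalEquality
  using (refl; sym; trans; cong; cong₂; subst; subst₂; module ≡-Reasoning)
import Relation.Binary.Reasoning.Setoid as SetoidReasoning
open import Relation.Nullary using (¬_; Dec; yes; no; contradiction)
open import Relation.Nullary.Decidable using (decidable-stable; from-yes; map′; ¬?; _×-dec_; _⊎-dec_; _→-dec_)

-- `U` is unimodular, so the radical modulo 3 of (-K) ⊕ U is that of -K plus 3U, and norms from 3U
-- vanish modulo 9. The summand `U` therefore cannot hide a difference between two lattices -K, and
-- no cancellation theorem is called for. The determinant would be a simpler invariant, but it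
-- separates only d = 2 (-8 against -72); for d = 3 and d = 6 the two candidates share -12 and -24.
-- When χ d = 0 the first norm is a unit modulo 3, so the norms in the radical are, modulo 9, the
-- second norm times squares. The positive half needs bases of all of α^⊥ over ℤ, not of a
-- sublattice of finite index. Each is therefore cut out of a unimodular frame of ℤ³ that has two
-- vectors in α^⊥ and one transverse to it. Equal Gram matrices over ℤ then give isometric walls
-- and, for d = 3, isometry over every ℤₚ at once.

open SemiringSum ℤₚ.+-*-semiring
  using (sum; sum-cong-≋; ∑-comm; *-distribˡ-sum; *-distribʳ-sum; sum-replicate-zero)

-- Linear combinations and coordinates

module _ (L : Lattice) where
  open Lattice L
  open CommutativeMonoidSum +ᴹ-commutativeMonoid using ()
    renaming (sum-cong-≋ to sumᴹ-cong; ∑-distrib-+ to sumᴹ-distrib-+)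

  combination-cong : ∀ {n} {c d : Vector ℤ n} v → (∀ i → c i ≡ d i) →
                     combination c v ≈ᴹ combination d v
  combination-cong v c≡d = sumᴹ-cong λ i → *ₗ-cong (c≡d i) ≈ᴹ-refl

  combination-+ : ∀ {n} (c d : Vector ℤ n) v →
                  combination (λ i → c i + d i) v ≈ᴹ combination c v +ᴹ combination d v
  combination-+ c d v = ≈ᴹ-trans
    (sumᴹ-cong λ i → *ₗ-distribʳ (v i) (c i) (d i))
    (sumᴹ-distrib-+ (λ i → c i *ₗ v i) (λ i → d i *ₗ v i))

  combination-* : ∀ {n} r (c : Vector ℤ n) v →
                  combination (λ i → r * c i) v ≈ᴹ r *ₗ combination c v
  combination-* {zero}  r c v = ≈ᴹ-sym (*ₗ-zeroʳ r)
  combination-* {suc n} r c v = ≈ᴹ-trans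
    (+ᴹ-cong (*ₗ-assoc r (c 0F) (v 0F)) (combination-* r (c ∘ fsuc) (v ∘ fsuc)))
    (≈ᴹ-sym (*ₗ-distribˡ r (c 0F *ₗ v 0F) (combination (c ∘ fsuc) (v ∘ fsuc))))

  combination-0 : ∀ {n} (v : Vector Carrierᴹ n) → combination (λ _ → 0ℤ) v ≈ᴹ 0ᴹ
  combination-0 v = ≈ᴹ-trans (combination-* 0ℤ (λ _ → 0ℤ) v) (*ₗ-zeroˡ _)

  ⟨⟩-0ˡ : ∀ y → ⟨ 0ᴹ , y ⟩ ≡ 0ℤ
  ⟨⟩-0ˡ y = trans (⟨⟩-cong (≈ᴹ-sym (*ₗ-zeroˡ 0ᴹ)) ≈ᴹ-refl) (⟨⟩-* 0ℤ 0ᴹ y)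

  ⟨⟩-combinationˡ : ∀ {n} (c : Vector ℤ n) v y →
                    ⟨ combination c v , y ⟩ ≡ sum λ i → c i * ⟨ v i , y ⟩
  ⟨⟩-combinationˡ {zero}  c v y = ⟨⟩-0ˡ y
  ⟨⟩-combinationˡ {suc n} c v y = trans
    (⟨⟩-+ (c 0F *ₗ v 0F) _ y)
    (cong₂ _+_ (⟨⟩-* (c 0F) (v 0F) y) (⟨⟩-combinationˡ (c ∘ fsuc) (v ∘ fsuc) y))

  ⟨⟩-combinationʳ : ∀ {n} (c : Vector ℤ n) v x →
                    ⟨ x , combination c v ⟩ ≡ sum λ i → ⟨ x , v i ⟩ * c i
  ⟨⟩-combinationʳ c v x = trans (⟨⟩-sym x _) (trans (⟨⟩-combinationˡ c v x)
    (sum-cong-≋ λ i → trans (ℤₚ.*-comm (c i) _) (cong (_* c i) (⟨⟩-sym (v i) x))))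

  ⟨⟩-combination : ∀ {m n} (c : Vector ℤ m) v (d : Vector ℤ n) w →
                   ⟨ combination c v , combination d w ⟩
                   ≡ sum λ i → sum λ j → c i * (⟨ v i , w j ⟩ * d j)
  ⟨⟩-combination c v d w = trans (⟨⟩-combinationˡ c v _) (sum-cong-≋ λ i →
    trans (cong (c i *_) (⟨⟩-combinationʳ d w (v i)))
          (*-distribˡ-sum (c i) (λ j → ⟨ v i , w j ⟩ * d j)))

module Coordinates {L n} (b : Basis L n) where
  open Lattice L
  open Basis b

  coord : Carrierᴹ → Vector ℤ n
  coord x = proj₁ (spanning x)

  combination-coord : ∀ x → combination (coord x) vec ≈ᴹ x
  combination-coord x = proj₂ (spanning x)

  -- `spanning` only supplies some coefficients; independence, applied to the difference, makes them
  -- unique. Every law of `coord` below is an instance of this.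
  combination-injective : ∀ {c d} → combination c vec ≈ᴹ combination d vec → ∀ i → c i ≡ d i
  combination-injective {c} {d} c≈d i = ℤₚ.i-j≡0⇒i≡j (c i) (d i)
    (trans (cong (λ t → c i + t) (sym (ℤₚ.-1*i≡-i (d i)))) (independent (λ i → c i + -1ℤ * d i) c-d≈0 i))
    where
    open SetoidReasoning ≈ᴹ-setoid
    c-d≈0 : combination (λ i → c i + -1ℤ * d i) vec ≈ᴹ 0ᴹ
    c-d≈0 = begin
      combination (λ i → c i + -1ℤ * d i) vec
        ≈⟨ combination-+ L c _ vec ⟩
      combination c vec +ᴹ combination (λ i → -1ℤ * d i) vec
        ≈⟨ +ᴹ-cong c≈d ≈ᴹ-refl ⟩
      combination d vec +ᴹ combination (λ i → -1ℤ * d i) vec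
        ≈⟨ combination-+ L d _ vec ⟨
      combination (λ i → d i + -1ℤ * d i) vec
        ≈⟨ combination-cong L vec (λ i → trans (cong (λ t → d i + t) (ℤₚ.-1*i≡-i (d i))) (ℤₚ.+-inverseʳ (d i))) ⟩
      combination (λ _ → 0ℤ) vec
        ≈⟨ combination-0 L vec ⟩
      0ᴹ ∎

  coord-cong : ∀ {x y} → x ≈ᴹ y → ∀ i → coord x i ≡ coord y i
  coord-cong {x} {y} x≈y = combination-injective
    (≈ᴹ-trans (combination-coord x) (≈ᴹ-trans x≈y (≈ᴹ-sym (combination-coord y))))

  coord-combination : ∀ c i → coord (combination c vec) i ≡ c i
  coord-combination c = combination-injective (combination-coord _)

  coord-+ : ∀ x y i → coord (x +ᴹ y) i ≡ coord x i + coord y i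
  coord-+ x y = combination-injective (≈ᴹ-trans (combination-coord _) (≈ᴹ-sym
    (≈ᴹ-trans (combination-+ L (coord x) (coord y) vec)
              (+ᴹ-cong (combination-coord x) (combination-coord y)))))

  coord-* : ∀ r x i → coord (r *ₗ x) i ≡ r * coord x i
  coord-* r x = combination-injective (≈ᴹ-trans (combination-coord _) (≈ᴹ-sym
    (≈ᴹ-trans (combination-* L r (coord x) vec) (*ₗ-cong refl (combination-coord x)))))

  ⟨⟩-coord : ∀ x y → ⟨ x , y ⟩ ≡ sum λ i → sum λ j → coord x i * (gram i j * coord y j)
  ⟨⟩-coord x y = trans
    (⟨⟩-cong (≈ᴹ-sym (combination-coord x)) (≈ᴹ-sym (combination-coord y)))
    (⟨⟩-combination L (coord x) vec (coord y) vec)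

  -- Divisibility of a linear functional can be tested on a basis. The factor `r` accommodates the 2
  -- in the reflection condition for roots.
  ∣⟨⟩ : ∀ {m r} x → (∀ j → m ∣ r * ⟨ x , vec j ⟩) → ∀ y → m ∣ r * ⟨ x , y ⟩
  ∣⟨⟩ {m} {r} x m∣ y = subst (m ∣_) (sym expand) (∣sum λ j → ∣m⇒∣m*n (coord y j) (m∣ j))
    where
    open ≡-Reasoning
    ∣sum : ∀ {n} {t : Vector ℤ n} → (∀ j → m ∣ t j) → m ∣ sum t
    ∣sum {zero}  m∣t = divides 0ℤ refl
    ∣sum {suc n} m∣t = ∣m∣n⇒∣m+n (m∣t 0F) (∣sum (m∣t ∘ fsuc))
    expand : r * ⟨ x , y ⟩ ≡ sum λ j → r * ⟨ x , vec j ⟩ * coord y j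
    expand = begin
      r * ⟨ x , y ⟩                             ≡⟨ cong (r *_) (⟨⟩-cong ≈ᴹ-refl (≈ᴹ-sym (combination-coord y))) ⟩
      r * ⟨ x , combination (coord y) vec ⟩     ≡⟨ cong (r *_) (⟨⟩-combinationʳ L (coord y) vec x) ⟩
      r * (sum λ j → ⟨ x , vec j ⟩ * coord y j) ≡⟨ *-distribˡ-sum r (λ j → ⟨ x , vec j ⟩ * coord y j) ⟩
      (sum λ j → r * (⟨ x , vec j ⟩ * coord y j)) ≡⟨ sum-cong-≋ (λ j → sym (ℤₚ.*-assoc r ⟨ x , vec j ⟩ (coord y j))) ⟩
      (sum λ j → r * ⟨ x , vec j ⟩ * coord y j) ∎

-- Isometries from equal Gram matrices

SameGram : ∀ {L M n} → Basis L n → Basis M n → Set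
SameGram b c = ∀ i j → Basis.gram b i j ≡ Basis.gram c i j

-- The isometry keeps the coordinates and exchanges the bases; its inverse does the same in the
-- other direction.
SameGram⇒≅ : ∀ {L M n} (b : Basis L n) (c : Basis M n) → SameGram b c → L ≅ M
SameGram⇒≅ {L} {M} b c same = f , isIso , isometry
  where
  module L = Lattice L
  module M = Lattice M
  module b where
    open Basis b public
    open Coordinates b public
  module c where
    open Basis c public
    open Coordinates c public
  open LeftModuleMorphisms L.rawLeftModule M.rawLeftModule using (IsLeftModuleIsomorphism)

  f : L.Carrierᴹ → M.Carrierᴹ
  f x = M.combination (b.coord x) c.vec

  f-cong : ∀ {x y} → x L.≈ᴹ y → f x M.≈ᴹ f y
  f-cong x≈y = combination-cong M c.vec (b.coord-cong x≈y)

  f-+ : ∀ x y → f (x L.+ᴹ y) M.≈ᴹ f x M.+ᴹ f y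
  f-+ x y = M.≈ᴹ-trans (combination-cong M c.vec (b.coord-+ x y)) (combination-+ M _ _ c.vec)

  f-* : ∀ r x → f (r L.*ₗ x) M.≈ᴹ r M.*ₗ f x
  f-* r x = M.≈ᴹ-trans (combination-cong M c.vec (b.coord-* r x)) (combination-* M r _ c.vec)

  f-0 : f L.0ᴹ M.≈ᴹ M.0ᴹ
  f-0 = M.≈ᴹ-trans (combination-cong M c.vec (b.independent _ (b.combination-coord L.0ᴹ)))
                   (combination-0 M c.vec)

  f-neg : ∀ x → f (L.-ᴹ x) M.≈ᴹ M.-ᴹ f x
  f-neg x = inverseˡ-unique (f (L.-ᴹ x)) (f x)
    (M.≈ᴹ-trans (M.≈ᴹ-sym (f-+ (L.-ᴹ x) x)) (M.≈ᴹ-trans (f-cong (L.-ᴹ‿inverseˡ x)) f-0))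
    where open GroupProperties M.+ᴹ-group using (inverseˡ-unique)

  f-injective : ∀ {x y} → f x M.≈ᴹ f y → x L.≈ᴹ y
  f-injective {x} {y} fx≈fy = L.≈ᴹ-trans (L.≈ᴹ-sym (b.combination-coord x)) (L.≈ᴹ-trans
    (combination-cong L b.vec (c.combination-injective fx≈fy)) (b.combination-coord y))

  f-preimage : ∀ y → f (L.combination (c.coord y) b.vec) M.≈ᴹ y
  f-preimage y = M.≈ᴹ-trans (combination-cong M c.vec (b.coord-combination (c.coord y)))
                            (c.combination-coord y)

  isIso : IsLeftModuleIsomorphism f
  isIso = record
    { isLeftModuleMonomorphism = record
      { isLeftModuleHomomorphism = record
        { +ᴹ-isGroupHomomorphism = record
          { isMonoidHomomorphism = record
            { isMagmaHomomorphism = record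
              { isRelHomomorphism = record { cong = f-cong } ; homo = f-+ }
            ; ε-homo = f-0
            }
          ; ⁻¹-homo = f-neg
          }
        ; *ₗ-homo = f-*
        }
      ; injective = f-injective
      }
    ; surjective = λ y → L.combination (c.coord y) b.vec ,
        λ z≈x → M.≈ᴹ-trans (f-cong z≈x) (f-preimage y)
    }

  isometry : ∀ x y → M.⟨ f x , f y ⟩ ≡ L.⟨ x , y ⟩
  isometry x y = trans (⟨⟩-combination M (b.coord x) c.vec (b.coord y) c.vec) (trans
    (sum-cong-≋ λ i → sum-cong-≋ λ j → cong (λ g → b.coord x i * (g * b.coord y j)) (sym (same i j)))
    (sym (b.⟨⟩-coord x y)))

⊕-congʳ : ∀ {L M} N → L ≅ M → L ⊕ N ≅ M ⊕ N
⊕-congʳ {L} {M} N (f , iso , isometry) = (λ (x , u) → f x , u) , record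
    { isLeftModuleMonomorphism = record
      { isLeftModuleHomomorphism = record
        { +ᴹ-isGroupHomomorphism = record
          { isMonoidHomomorphism = record
            { isMagmaHomomorphism = record
              { isRelHomomorphism = record { cong = λ (p , q) → f.⟦⟧-cong p , q }
              ; homo = λ (x , _) (y , _) → f.+ᴹ-homo x y , N.≈ᴹ-refl
              }
            ; ε-homo = f.0ᴹ-homo , N.≈ᴹ-refl
            }
          ; ⁻¹-homo = λ (x , _) → f.-ᴹ-homo x , N.≈ᴹ-refl
          }
        ; *ₗ-homo = λ r (x , _) → f.*ₗ-homo r x , N.≈ᴹ-refl
        }
      ; injective = λ (p , q) → f.injective p , q
      }
    ; surjective = λ (y , u) → (proj₁ (f.surjective y) , u) ,
        λ (p , q) → proj₂ (f.surjective y) p , q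
    }
  , λ (x , u) (y , v) → cong (_+ N.⟨ u , v ⟩) (isometry x y)
  where
  module N = Lattice N
  module f = LeftModuleMorphisms.IsLeftModuleIsomorphism iso

negateBasis : ∀ {L n} → Basis L n → Basis (negate L) n
negateBasis b = record { vec = vec ; spanning = spanning ; independent = independent }
  where open Basis b

module _ {L : Lattice} {n} (α : Lattice.Carrierᴹ L) (b : Basis L (suc n)) where
  open Lattice L
  open Basis b
  open Coordinates b

  -- Pairing a vector of α^⊥ with α leaves only its first coordinate times ⟨vec 0F, α⟩. As ℤ has no
  -- zero divisors that coordinate is 0, so the remaining basis vectors span the whole complement.
  orthogonalBasis : ⟨ vec 0F , α ⟩ ≢ 0ℤ → (∀ i → ⟨ vec (fsuc i) , α ⟩ ≡ 0ℤ) →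
                    Basis (orthogonal L α) n
  orthogonalBasis u∙α≢0 orth = record
    { vec = v
    ; spanning = λ (x , x∙α≡0) → coord x ∘ fsuc ,
        ≈ᴹ-trans (proj₁-combination (coord x ∘ fsuc) v)
          (≈ᴹ-trans (≈ᴹ-sym (drop-0 (coord x) (coord-0 x x∙α≡0))) (combination-coord x))
    ; independent = λ c c≈0 i → independent (0ℤ ∷ᵛ c)
        (≈ᴹ-trans (drop-0 (0ℤ ∷ᵛ c) refl) (≈ᴹ-trans (≈ᴹ-sym (proj₁-combination c v)) c≈0)) (fsuc i)
    }
    where
    open ≡-Reasoning
    v : Vector (Lattice.Carrierᴹ (orthogonal L α)) n
    v i = vec (fsuc i) , orth i

    proj₁-combination : ∀ {m} c (v : Vector (Lattice.Carrierᴹ (orthogonal L α)) m) →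
      proj₁ (Lattice.combination (orthogonal L α) c v) ≈ᴹ combination c (proj₁ ∘ v)
    proj₁-combination {zero}  c v = ≈ᴹ-refl
    proj₁-combination {suc m} c v = +ᴹ-cong ≈ᴹ-refl (proj₁-combination (c ∘ fsuc) (v ∘ fsuc))

    drop-0 : ∀ c → c 0F ≡ 0ℤ → combination c vec ≈ᴹ combination (c ∘ fsuc) (vec ∘ fsuc)
    drop-0 c c₀≡0 = ≈ᴹ-trans
      (+ᴹ-cong (≈ᴹ-trans (*ₗ-cong c₀≡0 ≈ᴹ-refl) (*ₗ-zeroˡ (vec 0F))) ≈ᴹ-refl) (+ᴹ-identityˡ _)

    coord-0 : ∀ x → ⟨ x , α ⟩ ≡ 0ℤ → coord x 0F ≡ 0ℤ
    coord-0 x x∙α≡0 with ℤₚ.i*j≡0⇒i≡0∨j≡0 (coord x 0F) product≡0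
      where
      rest≡0 : (sum λ i → coord x (fsuc i) * ⟨ vec (fsuc i) , α ⟩) ≡ 0ℤ
      rest≡0 = trans
        (sum-cong-≋ λ i → trans (cong (coord x (fsuc i) *_) (orth i)) (ℤₚ.*-zeroʳ (coord x (fsuc i))))
        (sum-replicate-zero n)
      product≡0 : coord x 0F * ⟨ vec 0F , α ⟩ ≡ 0ℤ
      product≡0 = begin
        coord x 0F * ⟨ vec 0F , α ⟩               ≡⟨ ℤₚ.+-identityʳ _ ⟨
        coord x 0F * ⟨ vec 0F , α ⟩ + 0ℤ          ≡⟨ cong (λ t → coord x 0F * ⟨ vec 0F , α ⟩ + t) rest≡0 ⟨
        (sum λ i → coord x i * ⟨ vec i , α ⟩)     ≡⟨ ⟨⟩-combinationˡ L (coord x) vec α ⟨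
        ⟨ combination (coord x) vec , α ⟩         ≡⟨ ⟨⟩-cong (combination-coord x) ≈ᴹ-refl ⟩
        ⟨ x , α ⟩                                 ≡⟨ x∙α≡0 ⟩
        0ℤ ∎
    ... | inj₁ x₀≡0 = x₀≡0
    ... | inj₂ u∙α≡0 = contradiction u∙α≡0 u∙α≢0

-- Bases of ℤⁿ from invertible matrices

infixl 7 _·_

_·_ : ∀ {m n} → Vector ℤ m → (Fin m → Vector ℤ n) → Vector ℤ n
(x · A) j = sum λ i → x i * A i j

δ : ∀ {n} → Matrix n
δ fzero    fzero    = 1ℤ
δ fzero    (fsuc _) = 0ℤ
δ (fsuc _) fzero    = 0ℤ
δ (fsuc i) (fsuc j) = δ i j

·-assoc : ∀ {l m n} x (A : Fin l → Vector ℤ m) (B : Fin m → Vector ℤ n) j →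
          (x · A · B) j ≡ (x · (λ i → A i · B)) j
·-assoc x A B j = begin
  (sum λ k → (sum λ i → x i * A i k) * B k j)   ≡⟨ sum-cong-≋ (λ k → *-distribʳ-sum (B k j) (λ i → x i * A i k)) ⟩
  (sum λ k → sum λ i → x i * A i k * B k j)     ≡⟨ ∑-comm (λ k i → x i * A i k * B k j) ⟩
  (sum λ i → sum λ k → x i * A i k * B k j)     ≡⟨ sum-cong-≋ (λ i → sum-cong-≋ λ k → ℤₚ.*-assoc (x i) (A i k) (B k j)) ⟩
  (sum λ i → sum λ k → x i * (A i k * B k j))   ≡⟨ sum-cong-≋ (λ i → sym (*-distribˡ-sum (x i) (λ k → A i k * B k j))) ⟩
  (sum λ i → x i * (A i · B) j)                 ∎
  where open ≡-Reasoning

·-zeroˡ : ∀ {m n} {x : Vector ℤ m} (A : Fin m → Vector ℤ n) → (∀ i → x i ≡ 0ℤ) → ∀ j → (x · A) j ≡ 0ℤ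
·-zeroˡ {m} A x≡0 j = trans (sum-cong-≋ λ i → cong (_* A i j) (x≡0 i)) (sum-replicate-zero m)

·-δ : ∀ {n} (x : Vector ℤ n) j → (x · δ) j ≡ x j
·-δ {suc n} x fzero = trans
  (cong₂ _+_ (ℤₚ.*-identityʳ (x 0F))
    (trans (sum-cong-≋ λ i → ℤₚ.*-zeroʳ (x (fsuc i))) (sum-replicate-zero n)))
  (ℤₚ.+-identityʳ (x 0F))
·-δ {suc n} x (fsuc j) = trans
  (cong₂ _+_ (ℤₚ.*-zeroʳ (x 0F)) (·-δ (x ∘ fsuc) j)) (ℤₚ.+-identityˡ (x (fsuc j)))

·-cancel : ∀ {n} (A B : Matrix n) → (∀ i j → (A i · B) j ≡ δ i j) → ∀ x j → (x · A · B) j ≡ x j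
·-cancel A B AB≡δ x j = trans (·-assoc x A B j)
  (trans (sum-cong-≋ λ i → cong (x i *_) (AB≡δ i j)) (·-δ x j))

-- The rows of `P` are the basis vectors and multiplication by `Q` reads off coordinates: QP = 1
-- gives spanning, PQ = 1 gives independence.
invertibleBasis : ∀ {n} {A : Matrix n} {A-sym : Symmetric A} (P Q : Matrix n) →
                  (∀ i j → (P i · Q) j ≡ δ i j) → (∀ i j → (Q i · P) j ≡ δ i j) →
                  Basis (gramLattice A A-sym) n
invertibleBasis {A = A} {A-sym} P Q PQ≡δ QP≡δ = record
  { vec = P
  ; spanning = λ x → x · Q , λ j → trans (combination≡· (x · Q) P j) (·-cancel Q P QP≡δ x j)
  ; independent = λ c cP≡0 i → trans (sym (·-cancel P Q PQ≡δ c i))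
      (·-zeroˡ Q (λ j → trans (sym (combination≡· c P j)) (cP≡0 j)) i)
  }
  where
  combination≡· : ∀ {m} c (P : Fin m → Vector ℤ _) j →
                  Lattice.combination (gramLattice A A-sym) c P j ≡ (c · P) j
  combination≡· {zero}  c P j = refl
  combination≡· {suc m} c P j = cong (λ t → c 0F * P 0F j + t) (combination≡· (c ∘ fsuc) (P ∘ fsuc) j)

-- Finite checks over lattices and wall classes

all-Index? : ∀ {P : Index → Set} → (∀ i → Dec (P i)) → Dec (∀ i → P i)
all-Index? P? = map′
  (λ { (p₁ , p₂ , p₃ , p₄) → λ { L₁ → p₁ ; L₂ → p₂ ; L₃ → p₃ ; L₄ → p₄ } })
  (λ p → p L₁ , p L₂ , p L₃ , p L₄)
  (P? L₁ ×-dec P? L₂ ×-dec P? L₃ ×-dec P? L₄)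

all-WallClass? : ∀ {P : WallClass → Set} → (∀ d → Dec (P d)) → Dec (∀ d → P d)
all-WallClass? P? = map′
  (λ { (p , q , r) → λ { d=2 → p ; d=3 → q ; d=6 → r } })
  (λ p → p d=2 , p d=3 , p d=6)
  (P? d=2 ×-dec P? d=3 ×-dec P? d=6)

_⇔-dec_ : ∀ {A B : Set} → Dec A → Dec B → Dec (A ⇔ B)
A? ⇔-dec B? = map′ (λ (f , g) → mk⇔ f g) (λ e → Equivalence.to e , Equivalence.from e)
  ((A? →-dec B?) ×-dec (B? →-dec A?))

_≟ᴵ_ : (i j : Index) → Dec (i ≡ j)
L₁ ≟ᴵ L₁ = yes refl
L₁ ≟ᴵ L₂ = no λ ()
L₁ ≟ᴵ L₃ = no λ ()
L₁ ≟ᴵ L₄ = no λ ()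
L₂ ≟ᴵ L₁ = no λ ()
L₂ ≟ᴵ L₂ = yes refl
L₂ ≟ᴵ L₃ = no λ ()
L₂ ≟ᴵ L₄ = no λ ()
L₃ ≟ᴵ L₁ = no λ ()
L₃ ≟ᴵ L₂ = no λ ()
L₃ ≟ᴵ L₃ = yes refl
L₃ ≟ᴵ L₄ = no λ ()
L₄ ≟ᴵ L₁ = no λ ()
L₄ ≟ᴵ L₂ = no λ ()
L₄ ≟ᴵ L₃ = no λ ()
L₄ ≟ᴵ L₄ = yes refl

-- Orthogonal bases of the lattices -K

χᴵ : WallClass → Index → Parity
χᴵ d i = χ d (bits i)

diagonal : ℤ → ℤ → Matrix 2
diagonal p q = (p ∷ᵛ 0ℤ ∷ᵛ []ᵛ) ∷ᵛ (0ℤ ∷ᵛ q ∷ᵛ []ᵛ) ∷ᵛ []ᵛ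

-- −K is isometric to the diagonal form with these entries for the value of χ d at its lattice.
p q : WallClass → Parity → ℤ
p d=2 0ℙ = - (+ 2)
p d=2 1ℙ = - (+ 6)
p d=3 0ℙ = + 2
p d=3 1ℙ = - (+ 2)
p d=6 0ℙ = - (+ 2)
p d=6 1ℙ = - (+ 4)
q d=2 0ℙ = + 4
q d=2 1ℙ = + 12
q d=3 0ℙ = - (+ 6)
q d=3 1ℙ = + 6
q d=6 0ℙ = + 12
q d=6 1ℙ = + 6

-- Rows 1 and 2 are an orthogonal basis of α^⊥; row 0 completes it to a positively oriented basis of ℤ³.
frame : WallClass → Index → Matrix 3
frame d=2 L₁ = (+ 0 ∷ᵛ + 0 ∷ᵛ + 1 ∷ᵛ []ᵛ) ∷ᵛ (+ 1 ∷ᵛ + 0 ∷ᵛ + 2 ∷ᵛ []ᵛ) ∷ᵛ (+ 2 ∷ᵛ + 1 ∷ᵛ + 4 ∷ᵛ []ᵛ) ∷ᵛ []ᵛ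
frame d=2 L₂ = (+ 1 ∷ᵛ + 0 ∷ᵛ + 1 ∷ᵛ []ᵛ) ∷ᵛ (+ 3 ∷ᵛ + 0 ∷ᵛ + 2 ∷ᵛ []ᵛ) ∷ᵛ (+ 6 ∷ᵛ + 1 ∷ᵛ + 4 ∷ᵛ []ᵛ) ∷ᵛ []ᵛ
frame d=2 L₃ = (+ 0 ∷ᵛ + 0 ∷ᵛ + 1 ∷ᵛ []ᵛ) ∷ᵛ (+ 2 ∷ᵛ + 1 ∷ᵛ + 4 ∷ᵛ []ᵛ) ∷ᵛ (+ 3 ∷ᵛ + 2 ∷ᵛ + 6 ∷ᵛ []ᵛ) ∷ᵛ []ᵛ
frame d=2 L₄ = (+ 1 ∷ᵛ + 0 ∷ᵛ + 1 ∷ᵛ []ᵛ) ∷ᵛ (+ 6 ∷ᵛ + 1 ∷ᵛ + 4 ∷ᵛ []ᵛ) ∷ᵛ (+ 9 ∷ᵛ + 2 ∷ᵛ + 6 ∷ᵛ []ᵛ) ∷ᵛ []ᵛ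
frame d=3 L₁ = (+ 0 ∷ᵛ + 0 ∷ᵛ -1ℤ ∷ᵛ []ᵛ) ∷ᵛ (+ 1 ∷ᵛ + 1 ∷ᵛ + 2 ∷ᵛ []ᵛ) ∷ᵛ (+ 1 ∷ᵛ + 0 ∷ᵛ + 0 ∷ᵛ []ᵛ) ∷ᵛ []ᵛ
frame d=3 L₂ = (+ 0 ∷ᵛ + 0 ∷ᵛ + 1 ∷ᵛ []ᵛ) ∷ᵛ (+ 1 ∷ᵛ + 0 ∷ᵛ + 0 ∷ᵛ []ᵛ) ∷ᵛ (+ 3 ∷ᵛ + 1 ∷ᵛ + 2 ∷ᵛ []ᵛ) ∷ᵛ []ᵛ
frame d=3 L₃ = (+ 0 ∷ᵛ + 1 ∷ᵛ + 0 ∷ᵛ []ᵛ) ∷ᵛ (+ 0 ∷ᵛ + 1 ∷ᵛ + 1 ∷ᵛ []ᵛ) ∷ᵛ (+ 1 ∷ᵛ + 3 ∷ᵛ + 3 ∷ᵛ []ᵛ) ∷ᵛ []ᵛ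
frame d=3 L₄ = (+ 0 ∷ᵛ + 0 ∷ᵛ + 1 ∷ᵛ []ᵛ) ∷ᵛ (+ 1 ∷ᵛ + 1 ∷ᵛ + 1 ∷ᵛ []ᵛ) ∷ᵛ (+ 0 ∷ᵛ + 1 ∷ᵛ + 1 ∷ᵛ []ᵛ) ∷ᵛ []ᵛ
frame d=6 L₁ = (+ 1 ∷ᵛ + 0 ∷ᵛ + 1 ∷ᵛ []ᵛ) ∷ᵛ (+ 0 ∷ᵛ + 1 ∷ᵛ + 1 ∷ᵛ []ᵛ) ∷ᵛ (+ 2 ∷ᵛ + 3 ∷ᵛ + 6 ∷ᵛ []ᵛ) ∷ᵛ []ᵛ
frame d=6 L₂ = (-1ℤ ∷ᵛ + 0 ∷ᵛ + 0 ∷ᵛ []ᵛ) ∷ᵛ (+ 2 ∷ᵛ + 0 ∷ᵛ + 1 ∷ᵛ []ᵛ) ∷ᵛ (+ 6 ∷ᵛ + 1 ∷ᵛ + 4 ∷ᵛ []ᵛ) ∷ᵛ []ᵛ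
frame d=6 L₃ = (+ 0 ∷ᵛ + 1 ∷ᵛ + 0 ∷ᵛ []ᵛ) ∷ᵛ (+ 0 ∷ᵛ + 2 ∷ᵛ + 1 ∷ᵛ []ᵛ) ∷ᵛ (+ 1 ∷ᵛ + 3 ∷ᵛ + 3 ∷ᵛ []ᵛ) ∷ᵛ []ᵛ
frame d=6 L₄ = (-1ℤ ∷ᵛ + 0 ∷ᵛ + 0 ∷ᵛ []ᵛ) ∷ᵛ (+ 2 ∷ᵛ + 0 ∷ᵛ + 1 ∷ᵛ []ᵛ) ∷ᵛ (+ 3 ∷ᵛ + 1 ∷ᵛ + 2 ∷ᵛ []ᵛ) ∷ᵛ []ᵛ

_×ᵛ_ : Vector ℤ 3 → Vector ℤ 3 → Vector ℤ 3
x ×ᵛ y = (x 1F * y 2F - x 2F * y 1F)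
      ∷ᵛ (x 2F * y 0F - x 0F * y 2F)
      ∷ᵛ (x 0F * y 1F - x 1F * y 0F)
      ∷ᵛ []ᵛ

-- Its columns are cross products of pairs of rows of `P`, so its product with `P` is the
-- determinant times the identity. Positive orientation of the frames makes it the inverse; this
-- accounts for the entries -1 in some of their first rows.
adjugate : Matrix 3 → Matrix 3
adjugate P j = (P 1F ×ᵛ P 2F) j ∷ᵛ (P 2F ×ᵛ P 0F) j ∷ᵛ (P 0F ×ᵛ P 1F) j ∷ᵛ []ᵛ

frameBasis : ∀ d i → Basis (lattice i) 3
frameBasis d i = invertibleBasis {A = G i} {G-sym i} (frame d i) (adjugate (frame d i)) (rightInverse d i) (leftInverse d i)
  where
  rightInverse : ∀ d i j k → (frame d i j · adjugate (frame d i)) k ≡ δ j k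
  rightInverse = from-yes (all-WallClass? λ d → all-Index? λ i → all? λ j → all? λ k →
    (frame d i j · adjugate (frame d i)) k ℤₚ.≟ δ j k)
  leftInverse : ∀ d i j k → (adjugate (frame d i) j · frame d i) k ≡ δ j k
  leftInverse = from-yes (all-WallClass? λ d → all-Index? λ i → all? λ j → all? λ k →
    (adjugate (frame d i) j · frame d i) k ℤₚ.≟ δ j k)

basis : ∀ d i → Basis (negate (K d i)) 2
basis d i = negateBasis {K d i} (orthogonalBasis {lattice i} (root d) (frameBasis d i) (transverse d i) (orth d i))
  where
  transverse : ∀ d i → form i (frame d i 0F) (root d) ≢ 0ℤ
  transverse = from-yes (all-WallClass? λ d → all-Index? λ i →
    ¬? (form i (frame d i 0F) (root d) ℤₚ.≟ 0ℤ))
  orth : ∀ d i j → form i (frame d i (fsuc j)) (root d) ≡ 0ℤ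
  orth = from-yes (all-WallClass? λ d → all-Index? λ i → all? λ j →
    form i (frame d i (fsuc j)) (root d) ℤₚ.≟ 0ℤ)

HasGram : ∀ {L n} → Basis L n → Matrix n → Set
HasGram b A = ∀ i j → Basis.gram b i j ≡ A i j

basis-gram : ∀ d i → HasGram (basis d i) (diagonal (p d (χᴵ d i)) (q d (χᴵ d i)))
basis-gram = from-yes (all-WallClass? λ d → all-Index? λ i → all? λ j → all? λ k →
  - form i (frame d i (fsuc j)) (frame d i (fsuc k)) ℤₚ.≟ diagonal (p d (χᴵ d i)) (q d (χᴵ d i)) j k)

basis-SameGram : ∀ d i j → χᴵ d i ≡ χᴵ d j → SameGram (basis d i) (basis d j)
basis-SameGram d i j χ≡ k l = trans (basis-gram d i k l)
  (trans (cong (λ c → diagonal (p d c) (q d c) k l) χ≡) (sym (basis-gram d j k l)))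

≡χ⇒SameWall : ∀ d i j → χᴵ d i ≡ χᴵ d j → SameWall d i j
≡χ⇒SameWall d i j χ≡ = ⊕-congʳ {L = negate (K d i)} {M = negate (K d j)} U
  (SameGram⇒≅ (basis d i) (basis d j) (basis-SameGram d i j χ≡))

-- The form in orthogonal coordinates

module _ {N : Lattice} (b : Basis N 2) {p q : ℤ} (b-gram : HasGram b (diagonal p q)) where
  open Lattice N
  open Basis b

  diagonal-⟨⟩ : ∀ c d → ⟨ combination c vec , combination d vec ⟩
                        ≡ p * (c 0F * d 0F) + q * (c 1F * d 1F)
  diagonal-⟨⟩ c d = trans (⟨⟩-combination N c vec d vec)
    (trans (sum-cong-≋ λ i → sum-cong-≋ λ j → cong (λ g → c i * (g * d j)) (b-gram i j))
           (expand p q (c 0F) (c 1F) (d 0F) (d 1F)))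
    where
    -- The left side is the double sum exactly as it unfolds, final zeros of the empty sums
    -- included.
    expand : ∀ p q c₀ c₁ d₀ d₁ →
      (c₀ * (p * d₀) + (c₀ * (+ 0 * d₁) + + 0)) + ((c₁ * (+ 0 * d₀) + (c₁ * (q * d₁) + + 0)) + + 0)
      ≡ p * (c₀ * d₀) + q * (c₁ * d₁)
    expand = solve-∀

  diagonal-⟨⟩-coord : let open Coordinates b in
    ∀ x y → ⟨ x , y ⟩ ≡ p * (coord x 0F * coord y 0F) + q * (coord x 1F * coord y 1F)
  diagonal-⟨⟩-coord x y = trans
    (⟨⟩-cong (≈ᴹ-sym (combination-coord x)) (≈ᴹ-sym (combination-coord y)))
    (diagonal-⟨⟩ (coord x) (coord y))
    where open Coordinates b

U-⟨⟩ : ∀ u v → Lattice.⟨_,_⟩ U u v ≡ u 0F * v 1F + u 1F * v 0F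
U-⟨⟩ u v = expand (u 0F) (u 1F) (v 0F) (v 1F)
  where
  expand : ∀ u₀ u₁ v₀ v₁ →
    (u₀ * (+ 0 * v₀) + (u₀ * (+ 1 * v₁) + + 0)) + ((u₁ * (+ 1 * v₀) + (u₁ * (+ 0 * v₁) + + 0)) + + 0)
    ≡ u₀ * v₁ + u₁ * v₀
  expand = solve-∀

-- An isometry invariant at the prime 3

-- The radical is that of the form modulo 3.
RadicalRepresentsSix : Lattice → Set
RadicalRepresentsSix L = ∃[ x ] (∀ y → + 3 ∣ ⟨ x , y ⟩) × ⟨ x , x ⟩ ≡ + 6 [mod + 9 ]
  where open Lattice L

-- By surjectivity every test vector of `M` is an image, so pairings in `M` are pairings in `L` and
-- the radicals correspond.
≅⇒RadicalRepresentsSix⇔ : ∀ {L M} → L ≅ M → RadicalRepresentsSix L ⇔ RadicalRepresentsSix M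
≅⇒RadicalRepresentsSix⇔ {L} {M} (f , iso , isometry) = mk⇔ image preimage
  where
  module L = Lattice L
  module M = Lattice M
  g : M.Carrierᴹ → L.Carrierᴹ
  g y = proj₁ (LeftModuleMorphisms.IsLeftModuleIsomorphism.surjective iso y)
  f-g : ∀ y → f (g y) M.≈ᴹ y
  f-g y = proj₂ (LeftModuleMorphisms.IsLeftModuleIsomorphism.surjective iso y) L.≈ᴹ-refl

  image : RadicalRepresentsSix L → RadicalRepresentsSix M
  image (x , 3∣ , norm) = f x
    , (λ y → subst (+ 3 ∣_) (trans (sym (isometry x (g y))) (M.⟨⟩-cong M.≈ᴹ-refl (f-g y))) (3∣ (g y)))
    , subst (_≡ + 6 [mod + 9 ]) (sym (isometry x x)) norm

  preimage : RadicalRepresentsSix M → RadicalRepresentsSix L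
  preimage (y , 3∣ , norm) = g y
    , (λ x → subst (+ 3 ∣_) (trans (M.⟨⟩-cong (M.≈ᴹ-sym (f-g y)) M.≈ᴹ-refl) (isometry (g y) x)) (3∣ (f x)))
    , subst (_≡ + 6 [mod + 9 ]) (trans (sym (M.⟨⟩-cong (f-g y) (f-g y))) (isometry (g y) (g y))) norm

infix 4 _≡_[mod?_]

_≡_[mod?_] : ∀ x y m → Dec (x ≡ y [mod m ])
x ≡ y [mod? m ] = map′ congruent _≡_[mod_].divisible (m ∣? x - y)

≡residue : ∀ n .{{_ : NonZero n}} x → ∃[ r ] x ≡ + toℕ {n} r [mod + n ]
≡residue n x = fromℕ< (n%ℕd<d x n) , congruent (divides (x /ℕ n)
  (trans (cong₂ (λ x r → x - + r) (a≡a%ℕn+[a/ℕn]*n x n) (toℕ-fromℕ< (n%ℕd<d x n)))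
         (cancel (+ (x %ℕ n)) (x /ℕ n * + n))))
  where
  cancel : ∀ r s → (r + s) - r ≡ s
  cancel = solve-∀

module _ {p q : ℤ} {N : Lattice} (b : Basis N 2) (b-gram : HasGram b (diagonal p q)) where
  open Lattice (N ⊕ U)
  open Basis b using (vec)
  open Coordinates b
  private module N = Lattice N

  wall-⟨⟩ : ∀ {x y} c d u v → N.combination c vec N.≈ᴹ x → N.combination d vec N.≈ᴹ y →
            ⟨ (x , u) , (y , v) ⟩ ≡ (p * (c 0F * d 0F) + q * (c 1F * d 1F)) + (u 0F * v 1F + u 1F * v 0F)
  wall-⟨⟩ c d u v c≈x d≈y = cong₂ _+_
    (trans (N.⟨⟩-cong (N.≈ᴹ-sym c≈x) (N.≈ᴹ-sym d≈y)) (diagonal-⟨⟩ b b-gram c d)) (U-⟨⟩ u v)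

  -- The witness is `a` times the first basis vector plus the second, with zero component in `U`:
  -- its pairings are combinations of `a * p` and `q`, its norm is p a² + q.
  radicalRepresentsSix : ∀ a → + 3 ∣ a * p → + 3 ∣ q → p * (a * a) + q ≡ + 6 [mod + 9 ] →
                         RadicalRepresentsSix (N ⊕ U)
  radicalRepresentsSix a 3∣ap 3∣q norm = x , radical , subst (_≡ + 6 [mod + 9 ]) (sym norm≡) norm
    where
    c : Vector ℤ 2
    c = a ∷ᵛ + 1 ∷ᵛ []ᵛ
    x : Carrierᴹ
    x = N.combination c vec , λ _ → + 0
    simplify : ∀ p q a d₀ d₁ v₀ v₁ →
      (p * (a * d₀) + q * (+ 1 * d₁)) + (+ 0 * v₁ + + 0 * v₀) ≡ a * p * d₀ + q * d₁
    simplify = solve-∀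
    radical : ∀ y → + 3 ∣ ⟨ x , y ⟩
    radical (y , v) = subst (+ 3 ∣_) (sym (trans
      (wall-⟨⟩ c (coord y) (λ _ → + 0) v N.≈ᴹ-refl (combination-coord y))
      (simplify p q a (coord y 0F) (coord y 1F) (v 0F) (v 1F))))
      (∣m∣n⇒∣m+n (∣m⇒∣m*n (coord y 0F) 3∣ap) (∣m⇒∣m*n (coord y 1F) 3∣q))
    simplify′ : ∀ p q a → (p * (a * a) + q * (+ 1 * + 1)) + (+ 0 * + 0 + + 0 * + 0) ≡ p * (a * a) + q
    simplify′ = solve-∀
    norm≡ : ⟨ x , x ⟩ ≡ p * (a * a) + q
    norm≡ = trans (wall-⟨⟩ c c (λ _ → + 0) (λ _ → + 0) N.≈ᴹ-refl N.≈ᴹ-refl) (simplify′ p q a)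

  -- Pairing a radical vector with the first basis vector and with the two generators of `U` shows
  -- that 3 divides `c 0F`, `u 0F` and `u 1F`. Their contributions to the norm vanish modulo 9,
  -- leaving q times the square of `c 1F`, which stays arbitrary.
  ¬radicalRepresentsSix : p * p ≡ + 1 [mod + 3 ] → (∀ c → ¬ q * (c * c) ≡ + 6 [mod + 9 ]) →
                          ¬ RadicalRepresentsSix (N ⊕ U)
  ¬radicalRepresentsSix p²≡1 q-six ((x , u) , radical , norm) =
    q-six (coord x 1F) (congruent (subst (+ 9 ∣_) (cancel p q (c 0F) (c 1F) (u 0F) (u 1F))
      (∣m∣n⇒∣m+n (_≡_[mod_].divisible (subst (_≡ + 6 [mod + 9 ]) norm≡ norm))
        (∣m∣n⇒∣m+n (∣n⇒∣m*n (- p) (9∣ 3∣c₀ 3∣c₀)) (∣n⇒∣m*n (- (+ 2)) (9∣ 3∣u₀ 3∣u₁))))))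
    where
    open _≡_[mod_]
    c : Vector ℤ 2
    c = coord x
    9∣ : ∀ {s t} → + 3 ∣ s → + 3 ∣ t → + 9 ∣ s * t
    9∣ (divides s′ refl) (divides t′ refl) = divides (s′ * t′) (regroup s′ t′)
      where
      regroup : ∀ s t → (s * + 3) * (t * + 3) ≡ (s * t) * + 9
      regroup = solve-∀
    3∣⟨⟩ : ∀ d v → + 3 ∣ (p * (c 0F * d 0F) + q * (c 1F * d 1F)) + (u 0F * v 1F + u 1F * v 0F)
    3∣⟨⟩ d v = subst (+ 3 ∣_) (wall-⟨⟩ c d u v (combination-coord x) N.≈ᴹ-refl)
      (radical (N.combination d vec , v))
    3∣u₀ : + 3 ∣ u 0F
    3∣u₀ = subst (+ 3 ∣_) (simplify p q (c 0F) (c 1F) (u 0F) (u 1F)) (3∣⟨⟩ (λ _ → + 0) (+ 0 ∷ᵛ + 1 ∷ᵛ []ᵛ))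
      where
      simplify : ∀ p q c₀ c₁ u₀ u₁ → (p * (c₀ * + 0) + q * (c₁ * + 0)) + (u₀ * + 1 + u₁ * + 0) ≡ u₀
      simplify = solve-∀
    3∣u₁ : + 3 ∣ u 1F
    3∣u₁ = subst (+ 3 ∣_) (simplify p q (c 0F) (c 1F) (u 0F) (u 1F)) (3∣⟨⟩ (λ _ → + 0) (+ 1 ∷ᵛ + 0 ∷ᵛ []ᵛ))
      where
      simplify : ∀ p q c₀ c₁ u₀ u₁ → (p * (c₀ * + 0) + q * (c₁ * + 0)) + (u₀ * + 0 + u₁ * + 1) ≡ u₁
      simplify = solve-∀
    3∣c₀ : + 3 ∣ c 0F
    -- Modulo 3, `p` is its own inverse: multiplying the pairing p c₀ by p recovers c₀.
    3∣c₀ = subst (+ 3 ∣_) (simplify p q (c 0F) (c 1F) (u 0F) (u 1F))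
      (∣m∣n⇒∣m+n (∣n⇒∣m*n p (3∣⟨⟩ (+ 1 ∷ᵛ + 0 ∷ᵛ []ᵛ) (λ _ → + 0))) (∣n⇒∣m*n (- c 0F) (divisible p²≡1)))
      where
      simplify : ∀ p q c₀ c₁ u₀ u₁ →
        p * ((p * (c₀ * + 1) + q * (c₁ * + 0)) + (u₀ * + 0 + u₁ * + 0)) + - c₀ * (p * p - + 1) ≡ c₀
      simplify = solve-∀
    norm≡ : ⟨ (x , u) , (x , u) ⟩
            ≡ (p * (c 0F * c 0F) + q * (c 1F * c 1F)) + (u 0F * u 1F + u 1F * u 0F)
    norm≡ = wall-⟨⟩ c c u u (combination-coord x) (combination-coord x)
    cancel : ∀ p q c₀ c₁ u₀ u₁ →
      (p * (c₀ * c₀) + q * (c₁ * c₁)) + (u₀ * u₁ + u₁ * u₀) - + 6 + (- p * (c₀ * c₀) + - (+ 2) * (u₀ * u₁))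
      ≡ q * (c₁ * c₁) - + 6
    cancel = solve-∀

-- Squares modulo `n` depend only on the residue of `c`, so `n` cases decide all integers.
*²-residues : ∀ n .{{_ : NonZero n}} p {t} →
              (∀ (r : Fin n) → ¬ p * (+ toℕ r * + toℕ r) ≡ t [mod + n ]) →
              ∀ c → ¬ p * (c * c) ≡ t [mod + n ]
*²-residues n p ¬residue c pc²≡t =
  let r , c≡r = ≡residue n c in
  ¬residue r (trans-mod (*-mod (≡⇒≡mod {p} refl) (*-mod (sym-mod c≡r) (sym-mod c≡r))) pc²≡t)
  where open Mod (+ n)

basis-gram-at : ∀ d i {c} → χᴵ d i ≡ c → HasGram (basis d i) (diagonal (p d c) (q d c))
basis-gram-at d i refl = basis-gram d i

χ≡1⇒radicalRepresentsSix : ∀ d i → χᴵ d i ≡ 1ℙ → RadicalRepresentsSix (wall d i)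
χ≡1⇒radicalRepresentsSix d i χ≡1 =
  radicalRepresentsSix (basis d i) (basis-gram-at d i χ≡1) (a d) (3∣ap d) (3∣q d) (norm d)
  where
  -- For d = 2 the form of −K vanishes modulo 3 and both basis vectors have norm 3 modulo 9,
  -- so their sum is needed.
  a : WallClass → ℤ
  a d=2 = + 1
  a d=3 = + 0
  a d=6 = + 0
  3∣ap : ∀ d → + 3 ∣ a d * p d 1ℙ
  3∣ap = from-yes (all-WallClass? λ d → + 3 ∣? a d * p d 1ℙ)
  3∣q : ∀ d → + 3 ∣ q d 1ℙ
  3∣q = from-yes (all-WallClass? λ d → + 3 ∣? q d 1ℙ)
  norm : ∀ d → p d 1ℙ * (a d * a d) + q d 1ℙ ≡ + 6 [mod + 9 ]
  norm = from-yes (all-WallClass? λ d → p d 1ℙ * (a d * a d) + q d 1ℙ ≡ + 6 [mod? + 9 ])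

-- Here p is 2 or -2 and q is 4, -6 or 12. Squares modulo 9 are 0, 1, 4, 7, so the values q c²
-- modulo 9 are 0, 1, 4, 7 for d = 2 and 0, 3 for the other classes.
χ≡0⇒¬radicalRepresentsSix : ∀ d i → χᴵ d i ≡ 0ℙ → ¬ RadicalRepresentsSix (wall d i)
χ≡0⇒¬radicalRepresentsSix d i χ≡0 =
  ¬radicalRepresentsSix (basis d i) (basis-gram-at d i χ≡0) (p²≡1 d) (*²-residues 9 (q d 0ℙ) (¬residue d))
  where
  p²≡1 : ∀ d → p d 0ℙ * p d 0ℙ ≡ + 1 [mod + 3 ]
  p²≡1 = from-yes (all-WallClass? λ d → p d 0ℙ * p d 0ℙ ≡ + 1 [mod? + 3 ])
  ¬residue : ∀ d (r : Fin 9) → ¬ q d 0ℙ * (+ toℕ r * + toℕ r) ≡ + 6 [mod + 9 ]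
  ¬residue = from-yes (all-WallClass? λ d → all? λ (r : Fin 9) →
    ¬? (q d 0ℙ * (+ toℕ r * + toℕ r) ≡ + 6 [mod? + 9 ]))

SameWall⇒≡χ : ∀ d i j → SameWall d i j → χᴵ d i ≡ χᴵ d j
SameWall⇒≡χ d i j same with χᴵ d i in χi | χᴵ d j in χj
... | 0ℙ | 0ℙ = refl
... | 1ℙ | 1ℙ = refl
... | 0ℙ | 1ℙ = contradiction
  (Equivalence.from (≅⇒RadicalRepresentsSix⇔ {wall d i} {wall d j} same) (χ≡1⇒radicalRepresentsSix d j χj))
  (χ≡0⇒¬radicalRepresentsSix d i χi)
... | 1ℙ | 0ℙ = contradiction
  (Equivalence.to (≅⇒RadicalRepresentsSix⇔ {wall d i} {wall d j} same) (χ≡1⇒radicalRepresentsSix d i χi))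
  (χ≡0⇒¬radicalRepresentsSix d j χj)

realizes-χ : ∀ d → Realizes d (χ d)
realizes-χ d i j = mk⇔ (SameWall⇒≡χ d i j) (≡χ⇒SameWall d i j)

-- Genera of -K for d = 3

module _ {p : ℕ} where
  open CommutativeRing (pAdicIntegers p) using (semiring) renaming (refl to ≈-refl)
  module ∑ₚ = SemiringSum semiring
  module PAdicLattice = Bilinear (pAdicIntegers p)

  residue-sum : ∀ {n} (t : Vector (PAdicInteger p) n) k →
                residue (∑ₚ.sum t) k ≡ sum λ i → residue (t i) k
  residue-sum {zero}  t k = refl
  residue-sum {suc n} t k = cong (λ s → residue (t 0F) k + s) (residue-sum (t ∘ fsuc) k)

  module _ {L n} (b : Basis L n) where
    open Basis b
    private module Lₚ = PAdicLattice.Lattice (localise p b)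

    residue-⟨⟩ : ∀ x y k → residue Lₚ.⟨ x , y ⟩ k
                 ≡ sum λ i → sum λ j → residue (x i) k * (gram i j * residue (y j) k)
    residue-⟨⟩ x y k = trans
      (residue-sum (λ i → ∑ₚ.sum λ j → ⟨⟩-term i j) k)
      (sum-cong-≋ λ i → residue-sum (⟨⟩-term i) k)
      where
      open CommutativeRing (pAdicIntegers p) using () renaming (_*_ to _*ₚ_)
      ⟨⟩-term : Fin n → Fin n → PAdicInteger p
      ⟨⟩-term i j = x i *ₚ (constant (gram i j) *ₚ y j)

  -- The p-adic isometry sends the integral vector `x` to a p-adic one; truncating the coordinates
  -- of the image at level `k` gives an integral vector whose norm is right modulo pᵏ.
  localise-represents : ∀ {L M n} (b : Basis L n) (c : Basis M n) →
    localise p b PAdicLattice.≅ localise p c → ∀ k x →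
    ∃[ y ] Lattice.⟨_,_⟩ M y y ≡ Lattice.⟨_,_⟩ L x x [mod (+ p) ℤ.^ k ]
  localise-represents {L} {M} b c (f , _ , isometry) k x =
    M.combination y c.vec , reduceMod (isometry x̂ x̂ k)
    where
    module M = Lattice M
    module b where
      open Basis b public
      open Coordinates b public
    module c = Basis c
    x̂ : Vector (PAdicInteger p) _
    x̂ i = constant (b.coord x i)
    y : Vector ℤ _
    y i = residue (f x̂ i) k
    reduceMod : residue (PAdicLattice.Lattice.⟨_,_⟩ (localise p c) (f x̂) (f x̂)) k
                 ≡ residue (PAdicLattice.Lattice.⟨_,_⟩ (localise p b) x̂ x̂) k [mod (+ p) ℤ.^ k ] →
                 M.⟨ M.combination y c.vec , M.combination y c.vec ⟩
                 ≡ Lattice.⟨_,_⟩ L x x [mod (+ p) ℤ.^ k ]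
    reduceMod e = subst₂ (λ s t → s ≡ t [mod (+ p) ℤ.^ k ])
      (trans (residue-⟨⟩ c (f x̂) (f x̂) k) (sym (⟨⟩-combination M y c.vec y c.vec)))
      (trans (residue-⟨⟩ b x̂ x̂ k) (sym (b.⟨⟩-coord x x))) e

  -- `localise` sees a lattice only through the Gram matrix of the chosen basis, so the identity on
  -- coordinate vectors is an isometry.
  localise-cong : ∀ {L M n} (b : Basis L n) (c : Basis M n) → SameGram b c →
                  localise p b PAdicLattice.≅ localise p c
  localise-cong {n = n} b c same = id
    , Identity.isLeftModuleIsomorphism (LeftModule.rawLeftModule (PAdicLattice.freeModule n)) (λ {x} i → ≈-refl {x i})
    , λ x y → ∑ₚ.sum-cong-≋ λ i → ∑ₚ.sum-cong-≋ λ j k →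
        Mod.≡⇒≡mod _ (cong (λ g → residue (x i) k * (g * residue (y j) k)) (sym (same i j)))

SameGenus⇒represents : ∀ {L M} → SameGenus L M → ∀ x →
  ∃[ y ] Lattice.⟨_,_⟩ M y y ≡ Lattice.⟨_,_⟩ L x x [mod + 3 ]
SameGenus⇒represents ((n , b , c , local) , _) = localise-represents b c (local 3 (from-yes (prime? 3))) 1

-- Each diagonal entry of a Gram matrix of `L` is a norm, hence modulo 3 a norm of `M`; as 3 divides
-- `q`, such a norm is p times a square.
SameGenus⇒residue : ∀ {L M n p q} (b : Basis L n) (c : Basis M 2) → HasGram c (diagonal p q) → + 3 ∣ q →
  SameGenus L M → ∀ i → ∃[ a ] p * (a * a) ≡ Basis.gram b i i [mod + 3 ]
SameGenus⇒residue {L} {M} {p = p} {q} b c c-gram 3∣q same i =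
  let y , y²≡b² = SameGenus⇒represents {L} {M} same (Basis.vec b i) in
  coord y 0F , trans-mod
    (congruent (subst (+ 3 ∣_) (sym (drop (p * (coord y 0F * coord y 0F)) (q * (coord y 1F * coord y 1F))))
      (∣m⇒∣-m (∣m⇒∣m*n (coord y 1F * coord y 1F) 3∣q))))
    (trans-mod (≡⇒≡mod (sym (diagonal-⟨⟩-coord c c-gram y y))) y²≡b²)
  where
  open Coordinates c
  open Mod (+ 3)
  drop : ∀ s t → s - (s + t) ≡ - t
  drop = solve-∀

-- The first basis vector has norm 2 or -2. These differ by the factor -1, a nonsquare modulo 3, so
-- neither is a square times the other.
SameGenus⇒≡χ : ∀ i j → SameGenus (negate (K d=3 i)) (negate (K d=3 j)) → χᴵ d=3 i ≡ χᴵ d=3 j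
SameGenus⇒≡χ i j same = decidable-stable (χᴵ d=3 i ℙₚ.≟ χᴵ d=3 j) λ χ≢ → contradiction
  (subst (λ t → p d=3 (χᴵ d=3 j) * (a * a) ≡ t [mod + 3 ]) (basis-gram d=3 i 0F 0F) (proj₂ represented))
  (*²-residues 3 (p d=3 (χᴵ d=3 j)) (¬residue i j χ≢) a)
  where
  3∣q : ∀ j → + 3 ∣ q d=3 (χᴵ d=3 j)
  3∣q = from-yes (all-Index? λ j → + 3 ∣? q d=3 (χᴵ d=3 j))
  ¬residue : ∀ i j → χᴵ d=3 i ≢ χᴵ d=3 j → ∀ (r : Fin 3) →
             ¬ p d=3 (χᴵ d=3 j) * (+ toℕ r * + toℕ r) ≡ p d=3 (χᴵ d=3 i) [mod + 3 ]
  ¬residue = from-yes (all-Index? λ i → all-Index? λ j → ¬? (χᴵ d=3 i ℙₚ.≟ χᴵ d=3 j) →-dec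
    (all? λ (r : Fin 3) → ¬? (p d=3 (χᴵ d=3 j) * (+ toℕ r * + toℕ r) ≡ p d=3 (χᴵ d=3 i) [mod? + 3 ])))
  represented : ∃[ a ] p d=3 (χᴵ d=3 j) * (a * a) ≡ Basis.gram (basis d=3 i) 0F 0F [mod + 3 ]
  represented = SameGenus⇒residue (basis d=3 i) (basis d=3 j) (basis-gram d=3 j) (3∣q j) same 0F
  a : ℤ
  a = proj₁ represented

orthogonalPair⇒signature : ∀ {L} → let open Lattice L in Basis L 2 → ∀ v w →
  0ℤ ℤ.< ⟨ v , v ⟩ → ⟨ w , w ⟩ ℤ.< 0ℤ → ⟨ v , w ⟩ ≡ 0ℤ → HasSignature L 1 1
orthogonalPair⇒signature b v w 0<v² w²<0 v∙w≡0 = record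
  { basis = b
  ; pos = λ _ → v
  ; neg = λ _ → w
  ; pos-norm = λ _ → 0<v²
  ; neg-norm = λ _ → w²<0
  ; pos-orth = λ { 0F 0F 0≢0 → contradiction refl 0≢0 }
  ; neg-orth = λ { 0F 0F 0≢0 → contradiction refl 0≢0 }
  ; orth = λ _ _ → v∙w≡0
  }

signature : ∀ d i → HasSignature (negate (K d i)) 1 1
signature d i = orthogonalPair⇒signature (basis d i)
  (Basis.vec (basis d i) (pos d (χᴵ d i))) (Basis.vec (basis d i) (neg d (χᴵ d i)))
  (proj₁ (signs d i)) (proj₁ (proj₂ (signs d i))) (proj₂ (proj₂ (signs d i)))
  where
  -- Only ⟨2⟩ ⊕ ⟨-6⟩ has its positive vector first.
  pos neg : WallClass → Parity → Fin 2
  pos d=3 0ℙ = 0F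
  pos _   _  = 1F
  neg d=3 0ℙ = 1F
  neg _   _  = 0F
  signs : ∀ d i → let gram = Basis.gram (basis d i) ; s = pos d (χᴵ d i) ; t = neg d (χᴵ d i) in
          0ℤ ℤ.< gram s s × gram t t ℤ.< 0ℤ × gram s t ≡ 0ℤ
  signs = from-yes (all-WallClass? λ d → all-Index? λ i →
    let gram = Basis.gram (basis d i) ; s = pos d (χᴵ d i) ; t = neg d (χᴵ d i) in
    (0ℤ ℤₚ.<? gram s s) ×-dec (gram t t ℤₚ.<? 0ℤ) ×-dec (gram s t ℤₚ.≟ 0ℤ))

≡χ⇒SameGenus : ∀ i j → χᴵ d=3 i ≡ χᴵ d=3 j → SameGenus (negate (K d=3 i)) (negate (K d=3 j))
≡χ⇒SameGenus i j χ≡ =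
    (2 , basis d=3 i , basis d=3 j ,
      λ p _ → localise-cong (basis d=3 i) (basis d=3 j) (basis-SameGram d=3 i j χ≡))
  , 1 , 1 , signature d=3 i , signature d=3 j

det-wall-3 : ∀ i → det (Basis.gram (basis d=3 i)) ≡ - (+ 12)
det-wall-3 = from-yes (all-Index? λ i → det (Basis.gram (basis d=3 i)) ℤₚ.≟ - (+ 12))

-- Partitions and characters

partition : ∀ {_~_ : Index → Index → Set} {φ : Index → Parity} {A B} →
  (∀ i j → (i ~ j) ⇔ (φ i ≡ φ j)) → (λ i j → φ i ≡ φ j) IsPartition A ∣∣ B → _~_ IsPartition A ∣∣ B
partition ~⇔≡ fibres i j = fibres i j ⇔-∘ ~⇔≡ i j

fibres? : ∀ (φ : Index → Parity) A B → Dec ((λ i j → φ i ≡ φ j) IsPartition A ∣∣ B)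
fibres? φ A B = all-Index? λ i → all-Index? λ j → (φ i ℙₚ.≟ φ j) ⇔-dec
  (((i ∈? A) ×-dec (j ∈? A)) ⊎-dec ((i ∈? B) ×-dec (j ∈? B)))
  where open DecMembership _≟ᴵ_ using (_∈?_)

exactlyTwoClasses : ∀ d → ExactlyTwoClasses (SameWall d)
exactlyTwoClasses d = L₁ , other d
  , proj₁ (classes d) ∘ SameWall⇒≡χ d L₁ (other d)
  , λ k → Sum.map (≡χ⇒SameWall d k L₁) (≡χ⇒SameWall d k (other d)) (proj₂ (classes d) k)
  where
  -- A lattice where χ d is 1; at `L₁`, with bits (0, 0), every χ d is 0.
  other : WallClass → Index
  other d=2 = L₂
  other d=3 = L₂
  other d=6 = L₃
  classes : ∀ d → χᴵ d L₁ ≢ χᴵ d (other d) × (∀ k → χᴵ d k ≡ χᴵ d L₁ ⊎ χᴵ d k ≡ χᴵ d (other d))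
  classes = from-yes (all-WallClass? λ d → ¬? (χᴵ d L₁ ℙₚ.≟ χᴵ d (other d)) ×-dec
    (all-Index? λ k → (χᴵ d k ℙₚ.≟ χᴵ d L₁) ⊎-dec (χᴵ d k ℙₚ.≟ χᴵ d (other d))))

χ-nontrivial : ∀ d → NontrivialCharacter (χ d)
χ-nontrivial d = record
    { isMonoidHomomorphism = record
      { isMagmaHomomorphism = record
        { isRelHomomorphism = record { cong = λ { (refl , refl) → refl } }
        ; homo = homo d
        }
      ; ε-homo = ε-homo d
      }
    ; ⁻¹-homo = λ _ → refl
    }
  , nontrivial d
  where
  open CommutativeSemigroupProperties ℙₚ.+-commutativeSemigroup using (interchange)
  homo : ∀ d x y → χ d (Group._∙_ [ℤ/2]² x y) ≡ χ d x +ℙ χ d y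
  homo d=2 _ _ = refl
  homo d=3 (a , b) (a′ , b′) = interchange a a′ b b′
  homo d=6 _ _ = refl
  ε-homo : ∀ d → χ d (0ℙ , 0ℙ) ≡ 0ℙ
  ε-homo d=2 = refl
  ε-homo d=3 = refl
  ε-homo d=6 = refl
  nontrivial : ∀ d → ∃[ g ] χ d g ≢ 0ℙ
  nontrivial d=2 = (1ℙ , 0ℙ) , λ ()
  nontrivial d=3 = (1ℙ , 0ℙ) , λ ()
  nontrivial d=6 = (0ℙ , 1ℙ) , λ ()

module _ {f : Parity × Parity → Parity} where
  open GroupMorphisms (Group.rawGroup [ℤ/2]²) (Group.rawGroup ℤ/2) using (IsGroupHomomorphism)

  character-formula : IsGroupHomomorphism f → ∀ a b →
    f (a , b) ≡ (a *ℙ f (1ℙ , 0ℙ)) +ℙ (b *ℙ f (0ℙ , 1ℙ))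
  character-formula hom 0ℙ 0ℙ = IsGroupHomomorphism.ε-homo hom
  character-formula hom 0ℙ 1ℙ = refl
  character-formula hom 1ℙ 0ℙ = sym (ℙₚ.+-identityʳ (f (1ℙ , 0ℙ)))
  character-formula hom 1ℙ 1ℙ = IsGroupHomomorphism.homo hom (1ℙ , 0ℙ) (0ℙ , 1ℙ)

  -- A character is fixed by its values on the two generators. Both zero is the trivial one; the
  -- other three pairs of values give a, b and a + b.
  nontrivialCharacter≡χ : NontrivialCharacter f → ∃[ d ] ∀ g → f g ≡ χ d g
  nontrivialCharacter≡χ (hom , (a , b) , fg≢0)
    -- Abstracting the formula together with the two values makes each case rewrite it.
    with f (1ℙ , 0ℙ) | f (0ℙ , 1ℙ) | character-formula hom
  ... | 0ℙ | 0ℙ | f≡ = contradiction (trans (f≡ a b) (cong₂ _+ℙ_ (ℙₚ.*-zeroʳ a) (ℙₚ.*-zeroʳ b))) fg≢0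
  ... | 1ℙ | 0ℙ | f≡ = d=2 , λ (a , b) → trans (f≡ a b)
    (trans (cong₂ _+ℙ_ (ℙₚ.*-identityʳ a) (ℙₚ.*-zeroʳ b)) (ℙₚ.+-identityʳ a))
  ... | 0ℙ | 1ℙ | f≡ = d=6 , λ (a , b) → trans (f≡ a b) (cong₂ _+ℙ_ (ℙₚ.*-zeroʳ a) (ℙₚ.*-identityʳ b))
  ... | 1ℙ | 1ℙ | f≡ = d=3 , λ (a , b) → trans (f≡ a b) (cong₂ _+ℙ_ (ℙₚ.*-identityʳ a) (ℙₚ.*-identityʳ b))

  -- Each kernel has one nonzero element, carried by `partner d`, and distinct kernels meet only in
  -- (0, 0). So `partner d` lying with `L₁` in the kernel of χ d′ forces d = d′.
  realizes-unique : ∀ {d d′} → Realizes d f → Realizes d′ f → d ≡ d′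
  realizes-unique {d} {d′} real real′ = kernels d d′ (SameWall⇒≡χ d′ L₁ (partner d)
    (Equivalence.from (real′ L₁ (partner d)) (Equivalence.to (real L₁ (partner d))
      (≡χ⇒SameWall d L₁ (partner d) (in-kernel d)))))
    where
    partner : WallClass → Index
    partner d=2 = L₃
    partner d=3 = L₄
    partner d=6 = L₂
    in-kernel : ∀ d → χᴵ d L₁ ≡ χᴵ d (partner d)
    in-kernel d=2 = refl
    in-kernel d=3 = refl
    in-kernel d=6 = refl
    kernels : ∀ d d′ → χᴵ d′ L₁ ≡ χᴵ d′ (partner d) → d ≡ d′
    kernels d=2 d=2 _ = refl
    kernels d=3 d=3 _ = refl
    kernels d=6 d=6 _ = refl

  uniquelyRealized : NontrivialCharacter f → ∃! _≡_ λ d → Realizes d f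
  uniquelyRealized nontrivial = d , real , λ {d′} → realizes-unique {d} {d′} real
    where
    d : WallClass
    d = proj₁ (nontrivialCharacter≡χ nontrivial)
    f≡χ : ∀ g → f g ≡ χ d g
    f≡χ = proj₂ (nontrivialCharacter≡χ nontrivial)
    real : Realizes d f
    real i j = mk⇔
      (λ same → trans (f≡χ (bits i)) (trans (SameWall⇒≡χ d i j same) (sym (f≡χ (bits j)))))
      (λ f≡ → ≡χ⇒SameWall d i j (trans (sym (f≡χ (bits i))) (trans f≡ (f≡χ (bits j)))))

-- Roots and their squarefree labels

root-isRoot : ∀ d i → IsRoot (lattice i) (root d)
root-isRoot d i = record
  { indivisible = indivisible d
  ; positive = positive d i
  ; reflection = Coordinates.∣⟨⟩ (frameBasis d i) {form i (root d) (root d)} {+ 2} (root d) (reflection d i)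
  }
  where
  unit : ∀ {m x} → 1ℤ ≡ m * x → ∣ m ∣ ≡ 1
  unit {m} {x} 1≡mx = ℕₚ.m*n≡1⇒m≡1 ∣ m ∣ ∣ x ∣ (trans (sym (ℤₚ.abs-* m x)) (cong ∣_∣ (sym 1≡mx)))
  -- The root is a standard basis vector, so its coordinate 1 is a multiple of `m`.
  indivisible : ∀ d m x → (∀ k → root d k ≡ m * x k) → ∣ m ∣ ≡ 1
  indivisible d=2 m x α≡mx = unit {m} {x 0F} (α≡mx 0F)
  indivisible d=3 m x α≡mx = unit {m} {x 1F} (α≡mx 1F)
  indivisible d=6 m x α≡mx = unit {m} {x 2F} (α≡mx 2F)
  positive : ∀ d i → 0ℤ ℤ.< form i (root d) (root d)
  positive = from-yes (all-WallClass? λ d → all-Index? λ i → 0ℤ ℤₚ.<? form i (root d) (root d))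
  reflection : ∀ d i k → form i (root d) (root d) ∣ + 2 * form i (root d) (frame d i k)
  reflection = from-yes (all-WallClass? λ d → all-Index? λ i → all? λ k →
    form i (root d) (root d) ∣? + 2 * form i (root d) (frame d i k))

-- If m² divides a nonzero n then m divides n, so m ≤ n and the search is finite.
squarefree? : ∀ n .{{_ : NonZero n}} → Dec (Squarefree n)
squarefree? n = map′ unbounded (λ squarefree m → squarefree (toℕ m))
  (all? λ (m : Fin (suc n)) → (toℕ m ℕ.* toℕ m ℕDiv.∣? n) →-dec (toℕ m ℕₚ.≟ 1))
  where
  unbounded : (∀ (m : Fin (suc n)) → toℕ m ℕ.* toℕ m ℕDiv.∣ n → toℕ m ≡ 1) → Squarefree n
  unbounded bounded m m²∣n =
    subst (λ m → m ℕ.* m ℕDiv.∣ n → m ≡ 1) (toℕ-fromℕ< m<1+n) (bounded (fromℕ< m<1+n)) m²∣n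
    where
    m<1+n : m ℕ.< suc n
    m<1+n = ℕ.s≤s (ℕDiv.∣⇒≤ (ℕDiv.∣-trans (ℕDiv.m∣m*n m) m²∣n))

label-squarefree : ∀ d → Squarefree (label d)
label-squarefree d=2 = from-yes (squarefree? 2)
label-squarefree d=3 = from-yes (squarefree? 3)
label-squarefree d=6 = from-yes (squarefree? 6)

label-squarefreePart : ∀ d i → IsSquarefreePart (form i (root d) (root d) * + ∣ det (G i) ∣) (label d)
label-squarefreePart d i = label-squarefree d , scale d i , scales d i
  where
  -- The square root of α² |det G| / d; the determinants are -12, -36, -24, -72.
  scale : WallClass → Index → ℕ
  scale d=2 L₁ = 6
  scale d=2 L₂ = 6
  scale d=2 L₃ = 12
  scale d=2 L₄ = 12
  scale d=3 L₁ = 4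
  scale d=3 L₂ = 12
  scale d=3 L₃ = 4
  scale d=3 L₄ = 12
  scale d=6 L₁ = 2
  scale d=6 L₂ = 6
  scale d=6 L₃ = 4
  scale d=6 L₄ = 12
  scales : ∀ d i → scale d i ≢ 0
           × form i (root d) (root d) * + ∣ det (G i) ∣ ≡ + (label d ℕ.* (scale d i ℕ.* scale d i))
  scales = from-yes (all-WallClass? λ d → all-Index? λ i → ¬? (scale d i ℕₚ.≟ 0) ×-dec
    (form i (root d) (root d) * + ∣ det (G i) ∣ ℤₚ.≟ + (label d ℕ.* (scale d i ℕ.* scale d i))))

theorem10p7 : (∀ i d → IsRoot (lattice i) (root d)
    × IsSquarefreePart (form i (root d) (root d) * + ∣ det (G i) ∣) (label d))
    × (∀ d → ExactlyTwoClasses (SameWall d))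
    × (SameWall d=2 IsPartition (L₁ ∷ L₃ ∷ []) ∣∣ (L₂ ∷ L₄ ∷ []))
    × (SameWall d=3 IsPartition (L₁ ∷ L₄ ∷ []) ∣∣ (L₂ ∷ L₃ ∷ []))
    × (SameWall d=6 IsPartition (L₁ ∷ L₂ ∷ []) ∣∣ (L₃ ∷ L₄ ∷ []))
    × (∀ d → NontrivialCharacter (χ d) × Realizes d (χ d))
    × (∀ f → NontrivialCharacter f → ∃! _≡_ (λ d → Realizes d f))
    × (∀ i → HasDeterminant (negate (K d=3 i)) 2 (- (+ 12)))
    × ((λ i j → SameGenus (negate (K d=3 i)) (negate (K d=3 j))) IsPartition (L₁ ∷ L₄ ∷ []) ∣∣ (L₂ ∷ L₃ ∷ []))
    × (∀ i → form i e₁ e₂ ≡ 0ℤ × form i e₁ e₃ ≢ 0ℤ × form i e₂ e₃ ≢ 0ℤ)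
theorem10p7 =
    (λ i d → root-isRoot d i , label-squarefreePart d i)
  , exactlyTwoClasses
  , partition (realizes-χ d=2) (from-yes (fibres? (χᴵ d=2) (L₁ ∷ L₃ ∷ []) (L₂ ∷ L₄ ∷ [])))
  , partition (realizes-χ d=3) (from-yes (fibres? (χᴵ d=3) (L₁ ∷ L₄ ∷ []) (L₂ ∷ L₃ ∷ [])))
  , partition (realizes-χ d=6) (from-yes (fibres? (χᴵ d=6) (L₁ ∷ L₂ ∷ []) (L₃ ∷ L₄ ∷ [])))
  , (λ d → χ-nontrivial d , realizes-χ d)
  , (λ f → uniquelyRealized)
  , (λ i → basis d=3 i , det-wall-3 i)
  , partition (λ i j → mk⇔ (SameGenus⇒≡χ i j) (≡χ⇒SameGenus i j))
      (from-yes (fibres? (χᴵ d=3) (L₁ ∷ L₄ ∷ []) (L₂ ∷ L₃ ∷ [])))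
  , from-yes (all-Index? λ i →
      (form i e₁ e₂ ℤₚ.≟ 0ℤ) ×-dec ¬? (form i e₁ e₃ ℤₚ.≟ 0ℤ) ×-dec ¬? (form i e₂ e₃ ℤₚ.≟ 0ℤ))
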